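{- For every integer $m \ge 2$, $d(m, 4m) \le 409$.
   Context: An integral point set in $\mathbb{R}^m$ is a finite set $\mathcal{P}$ of points of the $m$-dimensional Euclidean space $\mathbb{R}^m$ such that the Euclidean distance between any two points of $\mathcal{P}$ is an integer and $\mathcal{P}$ is not contained in an $(m-1)$-dimensional (affine) hyperplane. Its diameter is $\operatorname{diam}(\mathcal{P}) = \max_{P_1, P_2 \in \mathcal{P}} |P_1P_2|$. The function $d(m,n)$ is the minimal possible diameter of an integral point set of $n$ points in $\mathbb{R}^m$. -}

module Defs where

open import Data.Nat as ℕ using (ℕ; zero; suc)
import Data.Nat.Properties as ℕ
open import Data.Nat.Coprimality using (1-coprimeTo) renaming (sym to coprime-sym)
open import Data.Integer as ℤ using (ℤ; +_; +[1+_]; +0; -[1+_])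
import Data.Integer.Properties as ℤ
open import Data.Rational as ℚ using (ℚ; mkℚ; 0ℚ; 1ℚ; ½; ∣_∣)
import Data.Rational.Properties as ℚ
import Data.Rational.Unnormalised as ℚᵘ
import Data.Rational.Unnormalised.Properties as ℚᵘ
open import Data.Rational.Solver using (module +-*-Solver)
open import Data.Fin using (Fin)
open import Data.Vec.Functional using (Vector; foldr; zipWith)
open import Data.Product using (∃-syntax; _×_; _,_; proj₁; proj₂)
open import Data.Sum using (inj₁; inj₂)
open import Relation.Binary.PropositionalEquality
open import Relation.Nullary using (¬_; yes; no; contradiction)

-- Rational arithmetic used to close Cauchy sequences under the operations.

private
  half-pos : ∀ {ε} → 0ℚ ℚ.< ε → 0ℚ ℚ.< ½ ℚ.* ε
  half-pos {ε} 0<ε = ℚ.positive⁻¹ (½ ℚ.* ε) {{ℚ.pos*pos⇒pos ½ ε {{ℚ.positive 0<ε}}}}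

  half+half : ∀ ε → ½ ℚ.* ε ℚ.+ ½ ℚ.* ε ≡ ε
  half+half ε = trans (sym (ℚ.*-distribʳ-+ ε ½ ½)) (ℚ.*-identityˡ ε)

  ≤-* : ∀ {a b c d} → 0ℚ ℚ.≤ a → 0ℚ ℚ.≤ d → a ℚ.≤ b → c ℚ.≤ d → a ℚ.* c ℚ.≤ b ℚ.* d
  ≤-* {a} {b} {c} {d} 0≤a 0≤d a≤b c≤d = ℚ.≤-trans
    (ℚ.*-monoˡ-≤-nonNeg a {{ℚ.nonNegative 0≤a}} c≤d)
    (ℚ.*-monoʳ-≤-nonNeg d {{ℚ.nonNegative 0≤d}} a≤b)

  quotient : ∀ B ε → 0ℚ ℚ.< B → 0ℚ ℚ.< ε → ∃[ η ] (0ℚ ℚ.< η × B ℚ.* η ≡ ε)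
  quotient B ε 0<B 0<ε =
    (ℚ.1/ B) ℚ.* ε
    , ℚ.positive⁻¹ _ {{ℚ.pos*pos⇒pos (ℚ.1/ B) {{ℚ.1/pos⇒pos B}} ε}}
    , trans (sym (ℚ.*-assoc B (ℚ.1/ B) ε))
        (trans (cong (ℚ._* ε) (ℚ.*-inverseʳ B)) (ℚ.*-identityˡ ε))
    where
    instance
      B>0 : ℚ.Positive B
      B>0 = ℚ.positive 0<B
      B≢0 : ℚ.NonZero B
      B≢0 = ℚ.pos⇒nonZero B
      ε>0 : ℚ.Positive ε
      ε>0 = ℚ.positive 0<ε

  p≤∣p∣ : ∀ p → p ℚ.≤ ∣ p ∣
  p≤∣p∣ p with ℚ.≤-total 0ℚ p
  ... | inj₁ 0≤p = ℚ.≤-reflexive (sym (ℚ.0≤p⇒∣p∣≡p 0≤p))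
  ... | inj₂ p≤0 = ℚ.≤-trans p≤0 (ℚ.0≤∣p∣ p)

  p≤q+∣p-q∣ : ∀ p q → p ℚ.≤ q ℚ.+ ∣ p ℚ.- q ∣
  p≤q+∣p-q∣ p q = subst (ℚ._≤ q ℚ.+ ∣ p ℚ.- q ∣)
    (solve 2 (λ p q → q :+ (p :- q) := p) refl p q)
    (ℚ.+-monoʳ-≤ q (p≤∣p∣ (p ℚ.- q)))
    where open +-*-Solver

  ∣p-q∣≡∣q-p∣ : ∀ p q → ∣ p ℚ.- q ∣ ≡ ∣ q ℚ.- p ∣
  ∣p-q∣≡∣q-p∣ p q = trans (sym (ℚ.∣-p∣≡∣p∣ (p ℚ.- q)))
    (cong ∣_∣ (solve 2 (λ p q → :- (p :- q) := q :- p) refl p q))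
    where open +-*-Solver

  ∣p∣≤∣q∣+∣p-q∣ : ∀ p q → ∣ p ∣ ℚ.≤ ∣ q ∣ ℚ.+ ∣ p ℚ.- q ∣
  ∣p∣≤∣q∣+∣p-q∣ p q = subst (λ t → ∣ t ∣ ℚ.≤ ∣ q ∣ ℚ.+ ∣ p ℚ.- q ∣)
    (solve 2 (λ p q → q :+ (p :- q) := p) refl p q)
    (ℚ.∣p+q∣≤∣p∣+∣q∣ q (p ℚ.- q))
    where open +-*-Solver

  ∣p-q∣<ε : ∀ {p q ε} → p ℚ.< q ℚ.+ ε → q ℚ.< p ℚ.+ ε → ∣ p ℚ.- q ∣ ℚ.< ε
  ∣p-q∣<ε {p} {q} {ε} p<q+ε q<p+ε with ℚ.∣p∣≡p∨∣p∣≡-p (p ℚ.- q)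
  ... | inj₁ eq = subst₂ ℚ._<_ (sym eq)
    (solve 2 (λ q ε → (q :+ ε) :- q := ε) refl q ε)
    (ℚ.+-monoˡ-< (ℚ.- q) p<q+ε)
    where open +-*-Solver
  ... | inj₂ eq = subst₂ ℚ._<_
    (trans (solve 2 (λ p q → q :- p := :- (p :- q)) refl p q) (sym eq))
    (solve 2 (λ p ε → (p :+ ε) :- p := ε) refl p ε)
    (ℚ.+-monoˡ-< (ℚ.- p) q<p+ε)
    where open +-*-Solver

-- Real numbers: Cauchy sequences of rationals, with equality _≈_ below.

IsCauchy : (ℕ → ℚ) → Set
IsCauchy s = ∀ ε → 0ℚ ℚ.< ε → ∃[ N ] ∀ i j → N ℕ.≤ i → N ℕ.≤ j →
             ∣ s i ℚ.- s j ∣ ℚ.< ε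

record ℝ : Set where
  constructor mkℝ
  field
    seq    : ℕ → ℚ
    cauchy : IsCauchy seq

open ℝ public

infix 4 _≤_ _≈_

_≤_ : ℝ → ℝ → Set
x ≤ y = ∀ ε → 0ℚ ℚ.< ε → ∃[ N ] ∀ i → N ℕ.≤ i → seq x i ℚ.< seq y i ℚ.+ ε

_≈_ : ℝ → ℝ → Set
x ≈ y = x ≤ y × y ≤ x

abstract
  const-cauchy : ∀ q → IsCauchy (λ _ → q)
  const-cauchy q ε 0<ε = 0 , λ _ _ _ _ →
    subst (ℚ._< ε) (sym (cong ∣_∣ (ℚ.+-inverseʳ q))) 0<ε

fromℚ : ℚ → ℝ
fromℚ q = mkℝ (λ _ → q) (const-cauchy q)

fromℤ : ℤ → ℝ
fromℤ k = fromℚ (k ℚ./ 1)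

0ℝ : ℝ
0ℝ = fromℚ 0ℚ

infixl 6 _+_ _-_
infixl 7 _*_
infix 8 -_

abstract
  +-cauchy : ∀ x y → IsCauchy (λ i → seq x i ℚ.+ seq y i)
  +-cauchy x y ε 0<ε
    with M , f ← cauchy x (½ ℚ.* ε) (half-pos 0<ε)
       | N , g ← cauchy y (½ ℚ.* ε) (half-pos 0<ε)
    = M ℕ.⊔ N , λ i j i≥ j≥ → let open ℚ.≤-Reasoning in begin-strict
        ∣ (seq x i ℚ.+ seq y i) ℚ.- (seq x j ℚ.+ seq y j) ∣
          ≡⟨ cong ∣_∣ (rearrange (seq x i) (seq y i) (seq x j) (seq y j)) ⟩
        ∣ (seq x i ℚ.- seq x j) ℚ.+ (seq y i ℚ.- seq y j) ∣
          ≤⟨ ℚ.∣p+q∣≤∣p∣+∣q∣ (seq x i ℚ.- seq x j) (seq y i ℚ.- seq y j) ⟩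
        ∣ seq x i ℚ.- seq x j ∣ ℚ.+ ∣ seq y i ℚ.- seq y j ∣
          <⟨ ℚ.+-mono-< (f i j (ℕ.m⊔n≤o⇒m≤o M N i≥) (ℕ.m⊔n≤o⇒m≤o M N j≥))
                        (g i j (ℕ.m⊔n≤o⇒n≤o M N i≥) (ℕ.m⊔n≤o⇒n≤o M N j≥)) ⟩
        ½ ℚ.* ε ℚ.+ ½ ℚ.* ε ≡⟨ half+half ε ⟩
        ε ∎
    where
    open +-*-Solver
    rearrange : ∀ a b c d → (a ℚ.+ b) ℚ.- (c ℚ.+ d) ≡ (a ℚ.- c) ℚ.+ (b ℚ.- d)
    rearrange = solve 4 (λ a b c d → (a :+ b) :- (c :+ d) := (a :- c) :+ (b :- d)) refl

_+_ : ℝ → ℝ → ℝ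
x + y = mkℝ (λ i → seq x i ℚ.+ seq y i) (+-cauchy x y)

abstract
  neg-cauchy : ∀ x → IsCauchy (λ i → ℚ.- seq x i)
  neg-cauchy x ε 0<ε with N , f ← cauchy x ε 0<ε =
    N , λ i j i≥ j≥ → subst (ℚ._< ε) (eq (seq x i) (seq x j)) (f i j i≥ j≥)
    where
    open +-*-Solver
    eq : ∀ a b → ∣ a ℚ.- b ∣ ≡ ∣ ℚ.- a ℚ.- ℚ.- b ∣
    eq a b = trans (∣p-q∣≡∣q-p∣ a b)
      (cong ∣_∣ (solve 2 (λ a b → b :- a := (:- a) :- (:- b)) refl a b))

-_ : ℝ → ℝ
- x = mkℝ (λ i → ℚ.- seq x i) (neg-cauchy x)

_-_ : ℝ → ℝ → ℝ
x - y = x + - y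

private
  bounded : ∀ x → ∃[ B ] ∃[ N ] (0ℚ ℚ.< B × (∀ i → N ℕ.≤ i → ∣ seq x i ∣ ℚ.< B))
  bounded x with N , f ← cauchy x 1ℚ (ℚ.positive⁻¹ 1ℚ) =
    ∣ seq x N ∣ ℚ.+ 1ℚ , N
    , ℚ.≤-<-trans (ℚ.0≤∣p∣ (seq x N)) (bound N ℕ.≤-refl) , bound
    where
    bound : ∀ i → N ℕ.≤ i → ∣ seq x i ∣ ℚ.< ∣ seq x N ∣ ℚ.+ 1ℚ
    bound i i≥ = ℚ.≤-<-trans (∣p∣≤∣q∣+∣p-q∣ (seq x i) (seq x N))
      (ℚ.+-monoʳ-< ∣ seq x N ∣ (f i N i≥ ℕ.≤-refl))

  product-< : ∀ {a b c d} → 0ℚ ℚ.< b → 0ℚ ℚ.≤ c → a ℚ.< b → c ℚ.< d →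
              a ℚ.* c ℚ.< b ℚ.* d
  product-< {a} {b} {c} {d} 0<b 0≤c a<b c<d = ℚ.≤-<-trans
    (ℚ.*-monoʳ-≤-nonNeg c {{ℚ.nonNegative 0≤c}} (ℚ.<⇒≤ a<b))
    (ℚ.*-monoʳ-<-pos b {{ℚ.positive 0<b}} c<d)

  products-close : ∀ {A B η θ} a b c d → 0ℚ ℚ.< A → 0ℚ ℚ.< B →
    ∣ a ∣ ℚ.< A → ∣ d ∣ ℚ.< B → ∣ a ℚ.- c ∣ ℚ.< θ → ∣ b ℚ.- d ∣ ℚ.< η →
    ∣ a ℚ.* b ℚ.- c ℚ.* d ∣ ℚ.< A ℚ.* η ℚ.+ B ℚ.* θ
  products-close {A} {B} {η} {θ} a b c d 0<A 0<B a<A d<B a-c<θ b-d<η = begin-strict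
    ∣ a ℚ.* b ℚ.- c ℚ.* d ∣
      ≡⟨ cong ∣_∣ (rearrange a b c d) ⟩
    ∣ a ℚ.* (b ℚ.- d) ℚ.+ d ℚ.* (a ℚ.- c) ∣
      ≤⟨ ℚ.∣p+q∣≤∣p∣+∣q∣ (a ℚ.* (b ℚ.- d)) (d ℚ.* (a ℚ.- c)) ⟩
    ∣ a ℚ.* (b ℚ.- d) ∣ ℚ.+ ∣ d ℚ.* (a ℚ.- c) ∣
      ≡⟨ cong₂ ℚ._+_ (ℚ.∣p*q∣≡∣p∣*∣q∣ a (b ℚ.- d)) (ℚ.∣p*q∣≡∣p∣*∣q∣ d (a ℚ.- c)) ⟩
    ∣ a ∣ ℚ.* ∣ b ℚ.- d ∣ ℚ.+ ∣ d ∣ ℚ.* ∣ a ℚ.- c ∣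
      <⟨ ℚ.+-mono-< (product-< 0<A (ℚ.0≤∣p∣ (b ℚ.- d)) a<A b-d<η)
                    (product-< 0<B (ℚ.0≤∣p∣ (a ℚ.- c)) d<B a-c<θ) ⟩
    A ℚ.* η ℚ.+ B ℚ.* θ ∎
    where
    open ℚ.≤-Reasoning
    rearrange : ∀ a b c d → a ℚ.* b ℚ.- c ℚ.* d ≡ a ℚ.* (b ℚ.- d) ℚ.+ d ℚ.* (a ℚ.- c)
    rearrange = solve 4 (λ a b c d →
      a :* b :- c :* d := a :* (b :- d) :+ d :* (a :- c)) refl
      where open +-*-Solver

abstract
  *-cauchy : ∀ x y → IsCauchy (λ i → seq x i ℚ.* seq y i)
  *-cauchy x y ε 0<ε =
    let A , K , 0<A , boundx = bounded x
        B , L , 0<B , boundy = bounded y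
        η , 0<η , Aη≡ = quotient A (½ ℚ.* ε) 0<A (half-pos 0<ε)
        θ , 0<θ , Bθ≡ = quotient B (½ ℚ.* ε) 0<B (half-pos 0<ε)
        M , f = cauchy x θ 0<θ
        N , g = cauchy y η 0<η
    in (K ℕ.⊔ L) ℕ.⊔ (M ℕ.⊔ N) , λ i j i≥ j≥ →
      let i≥KL = ℕ.m⊔n≤o⇒m≤o (K ℕ.⊔ L) (M ℕ.⊔ N) i≥
          i≥MN = ℕ.m⊔n≤o⇒n≤o (K ℕ.⊔ L) (M ℕ.⊔ N) i≥
          j≥KL = ℕ.m⊔n≤o⇒m≤o (K ℕ.⊔ L) (M ℕ.⊔ N) j≥
          j≥MN = ℕ.m⊔n≤o⇒n≤o (K ℕ.⊔ L) (M ℕ.⊔ N) j≥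
      in subst (∣ seq x i ℚ.* seq y i ℚ.- seq x j ℚ.* seq y j ∣ ℚ.<_)
        (trans (cong₂ ℚ._+_ Aη≡ Bθ≡) (half+half ε))
        (products-close (seq x i) (seq y i) (seq x j) (seq y j) 0<A 0<B
          (boundx i (ℕ.m⊔n≤o⇒m≤o K L i≥KL))
          (boundy j (ℕ.m⊔n≤o⇒n≤o K L j≥KL))
          (f i j (ℕ.m⊔n≤o⇒m≤o M N i≥MN) (ℕ.m⊔n≤o⇒m≤o M N j≥MN))
          (g i j (ℕ.m⊔n≤o⇒n≤o M N i≥MN) (ℕ.m⊔n≤o⇒n≤o M N j≥MN)))

_*_ : ℝ → ℝ → ℝ
x * y = mkℝ (λ i → seq x i ℚ.* seq y i) (*-cauchy x y)

-- The i-th term of √ x is a multiple r of δ i with r² ≤ |xᵢ| < (r + δ i)², so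
-- that √ x is the nonnegative square root of |x|; it is the usual square root
-- when x is nonnegative, by √-nonneg and √-square.

δ : ℕ → ℚ
δ i = mkℚ (+ 1) i (1-coprimeTo (suc i))

private
  0<δ : ∀ i → 0ℚ ℚ.< δ i
  0<δ i = ℚ.positive⁻¹ (δ i)

  δ-small : ∀ ε → 0ℚ ℚ.< ε → ∃[ N ] ∀ i → N ℕ.≤ i → δ i ℚ.≤ ε
  δ-small (mkℚ +[1+ a ] d c) _ = d , λ i d≤i → ℚ.*≤* (ℤ.+≤+ (begin
    1 ℕ.* suc d ≡⟨ ℕ.*-identityˡ (suc d) ⟩
    suc d ≤⟨ ℕ.s≤s d≤i ⟩
    suc i ≤⟨ ℕ.m≤n*m (suc i) (suc a) ⟩
    suc a ℕ.* suc i ∎))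
    where open ℕ.≤-Reasoning
  δ-small (mkℚ +0 d c) (ℚ.*<* (ℤ.+<+ ()))
  δ-small (mkℚ -[1+ a ] d c) (ℚ.*<* ())

  multiple : ℚ → ℕ → ℚ
  multiple r zero = 0ℚ
  multiple r (suc k) = multiple r k ℚ.+ r

  multiple-* : ∀ r s k → multiple (r ℚ.* s) k ≡ multiple r k ℚ.* s
  multiple-* r s zero = sym (ℚ.*-zeroˡ s)
  multiple-* r s (suc k) = trans (cong (ℚ._+ r ℚ.* s) (multiple-* r s k))
    (sym (ℚ.*-distribʳ-+ s (multiple r k) r))

  ≤multiple1 : ∀ q → ∃[ k ] q ℚ.≤ multiple 1ℚ k
  ≤multiple1 q = ℤ.∣ ℚ.↥ q ∣ , ℚ.≤-trans (q≤ q)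
    (ℚ.≤-reflexive (sym (integer ℤ.∣ ℚ.↥ q ∣)))
    where
    int : ℕ → ℚ
    int k = mkℚ (+ k) 0 (coprime-sym (1-coprimeTo k))
    integer : ∀ k → multiple 1ℚ k ≡ int k
    integer zero = refl
    integer (suc k) = trans (cong (ℚ._+ 1ℚ) (integer k))
      (ℚ.toℚᵘ-injective (ℚᵘ.≃-trans (ℚ.toℚᵘ-homo-+ (int k) 1ℚ)
        (ℚᵘ.*≡* (cong (ℤ._* + 1)
          (trans (cong (ℤ._+ + 1) (ℤ.*-identityʳ (+ k))) (cong +_ (ℕ.+-comm k 1)))))))
    q≤ : ∀ p → p ℚ.≤ int ℤ.∣ ℚ.↥ p ∣
    q≤ (mkℚ (+ n) d c) = ℚ.*≤* (subst (ℤ._≤ + n ℤ.* + suc d) (sym (ℤ.*-identityʳ (+ n)))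
      (subst (+ n ℤ.≤_) (ℤ.pos-* n (suc d)) (ℤ.+≤+ (ℕ.m≤m*n n (suc d)))))
    q≤ (mkℚ -[1+ n ] d c) = ℚ.*≤* ℤ.-≤+

  ≤multiple : ∀ r q → 0ℚ ℚ.< r → ∃[ k ] q ℚ.≤ multiple r k
  ≤multiple r q 0<r = k , subst₂ ℚ._≤_
      (trans (ℚ.*-assoc q (ℚ.1/ r) r)
        (trans (cong (q ℚ.*_) (ℚ.*-inverseˡ r)) (ℚ.*-identityʳ q)))
      (trans (sym (multiple-* 1ℚ r k)) (cong (λ t → multiple t k) (ℚ.*-identityˡ r)))
      (ℚ.*-monoʳ-≤-nonNeg r {{ℚ.nonNegative (ℚ.<⇒≤ 0<r)}} (proj₂ bound))
    where
    instance
      r≢0 : ℚ.NonZero r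
      r≢0 = ℚ.>-nonZero 0<r
    bound : ∃[ k ] q ℚ.* (ℚ.1/ r) ℚ.≤ multiple 1ℚ k
    bound = ≤multiple1 (q ℚ.* (ℚ.1/ r))
    k : ℕ
    k = proj₁ bound

  multiple-nonneg : ∀ r k → 0ℚ ℚ.≤ r → 0ℚ ℚ.≤ multiple r k
  multiple-nonneg r zero 0≤r = ℚ.≤-refl
  multiple-nonneg r (suc k) 0≤r = ℚ.+-mono-≤ (multiple-nonneg r k 0≤r) 0≤r

  q<[q+1]² : ∀ q → 0ℚ ℚ.≤ q → q ℚ.< (q ℚ.+ 1ℚ) ℚ.* (q ℚ.+ 1ℚ)
  q<[q+1]² q 0≤q = ℚ.<-≤-trans q<q+1 (subst (ℚ._≤ (q ℚ.+ 1ℚ) ℚ.* (q ℚ.+ 1ℚ))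
      (ℚ.*-identityˡ (q ℚ.+ 1ℚ))
      (≤-* (ℚ.nonNegative⁻¹ 1ℚ) (ℚ.≤-trans 0≤q (ℚ.<⇒≤ q<q+1)) (ℚ.+-monoˡ-≤ 1ℚ 0≤q) ℚ.≤-refl))
    where
    q<q+1 : q ℚ.< q ℚ.+ 1ℚ
    q<q+1 = subst (ℚ._< q ℚ.+ 1ℚ) (ℚ.+-identityʳ q) (ℚ.+-monoʳ-< q (ℚ.positive⁻¹ 1ℚ))

abstract
  approxRoot : ∀ r q → 0ℚ ℚ.< r → 0ℚ ℚ.≤ q →
    ∃[ s ] (0ℚ ℚ.≤ s × s ℚ.* s ℚ.≤ q × q ℚ.< (s ℚ.+ r) ℚ.* (s ℚ.+ r))
  approxRoot r q 0<r 0≤q with k , q+1≤kr ← ≤multiple r (q ℚ.+ 1ℚ) 0<r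
    = search k (ℚ.<-≤-trans (q<[q+1]² q 0≤q)
        (≤-* 0≤q+1 (ℚ.≤-trans 0≤q+1 q+1≤kr) q+1≤kr q+1≤kr))
    where
    0≤q+1 : 0ℚ ℚ.≤ q ℚ.+ 1ℚ
    0≤q+1 = ℚ.+-mono-≤ 0≤q (ℚ.nonNegative⁻¹ 1ℚ)
    search : ∀ k → q ℚ.< multiple r k ℚ.* multiple r k →
      ∃[ s ] (0ℚ ℚ.≤ s × s ℚ.* s ℚ.≤ q × q ℚ.< (s ℚ.+ r) ℚ.* (s ℚ.+ r))
    search zero q<0 = contradiction q<0 (λ q<0 → ℚ.<-irrefl refl (ℚ.≤-<-trans 0≤q q<0))
    search (suc k) q< with multiple r k ℚ.* multiple r k ℚ.≤? q
    ... | yes s²≤q = multiple r k , multiple-nonneg r k (ℚ.<⇒≤ 0<r) , s²≤q , q<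
    ... | no  s²≰q = search k (ℚ.≰⇒> s²≰q)

private
  roots-close : ∀ {p q r s t} ε → 0ℚ ℚ.< ε → 0ℚ ℚ.< r → r ℚ.≤ ½ ℚ.* ε →
    0ℚ ℚ.≤ t → s ℚ.* s ℚ.≤ p → q ℚ.< (t ℚ.+ r) ℚ.* (t ℚ.+ r) →
    p ℚ.≤ q ℚ.+ (½ ℚ.* ε) ℚ.* (½ ℚ.* ε) → s ℚ.< t ℚ.+ ε
  roots-close {p} {q} {r} {s} {t} ε 0<ε 0<r r≤h 0≤t s²≤p q<[t+r]² p≤q+h² with s ℚ.<? t ℚ.+ ε
  ... | yes s<t+ε = s<t+ε
  ... | no s≮t+ε = contradiction refl (ℚ.<⇒≢ absurd)
    where
    h : ℚ
    h = ½ ℚ.* ε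
    0≤h : 0ℚ ℚ.≤ h
    0≤h = ℚ.<⇒≤ (half-pos 0<ε)
    t+ε≤s : t ℚ.+ ε ℚ.≤ s
    t+ε≤s = ℚ.≮⇒≥ s≮t+ε
    0≤t+ε : 0ℚ ℚ.≤ t ℚ.+ ε
    0≤t+ε = ℚ.+-mono-≤ 0≤t (ℚ.<⇒≤ 0<ε)
    0≤t+h : 0ℚ ℚ.≤ t ℚ.+ h
    0≤t+h = ℚ.+-mono-≤ 0≤t 0≤h
    0≤cross : 0ℚ ℚ.≤ (t ℚ.+ h) ℚ.* h ℚ.+ (t ℚ.+ h) ℚ.* h
    0≤cross = ℚ.+-mono-≤ (nonneg-* 0≤t+h 0≤h) (nonneg-* 0≤t+h 0≤h)
      where
      nonneg-* : ∀ {a b} → 0ℚ ℚ.≤ a → 0ℚ ℚ.≤ b → 0ℚ ℚ.≤ a ℚ.* b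
      nonneg-* {a} {b} 0≤a 0≤b = subst (ℚ._≤ a ℚ.* b) (ℚ.*-zeroˡ b)
        (≤-* ℚ.≤-refl 0≤b 0≤a ℚ.≤-refl)
    open +-*-Solver
    absurd : (t ℚ.+ ε) ℚ.* (t ℚ.+ ε) ℚ.< (t ℚ.+ ε) ℚ.* (t ℚ.+ ε)
    absurd = let open ℚ.≤-Reasoning in begin-strict
      (t ℚ.+ ε) ℚ.* (t ℚ.+ ε)
        ≤⟨ ≤-* 0≤t+ε (ℚ.≤-trans 0≤t+ε t+ε≤s) t+ε≤s t+ε≤s ⟩
      s ℚ.* s ≤⟨ s²≤p ⟩
      p ≤⟨ p≤q+h² ⟩
      q ℚ.+ h ℚ.* h <⟨ ℚ.+-monoˡ-< (h ℚ.* h) q<[t+r]² ⟩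
      (t ℚ.+ r) ℚ.* (t ℚ.+ r) ℚ.+ h ℚ.* h
        ≤⟨ ℚ.+-monoˡ-≤ (h ℚ.* h)
             (≤-* (ℚ.+-mono-≤ 0≤t (ℚ.<⇒≤ 0<r)) 0≤t+h (ℚ.+-monoʳ-≤ t r≤h) (ℚ.+-monoʳ-≤ t r≤h)) ⟩
      (t ℚ.+ h) ℚ.* (t ℚ.+ h) ℚ.+ h ℚ.* h
        ≡⟨ ℚ.+-identityʳ ((t ℚ.+ h) ℚ.* (t ℚ.+ h) ℚ.+ h ℚ.* h) ⟨
      (t ℚ.+ h) ℚ.* (t ℚ.+ h) ℚ.+ h ℚ.* h ℚ.+ 0ℚ
        ≤⟨ ℚ.+-monoʳ-≤ ((t ℚ.+ h) ℚ.* (t ℚ.+ h) ℚ.+ h ℚ.* h) 0≤cross ⟩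
      (t ℚ.+ h) ℚ.* (t ℚ.+ h) ℚ.+ h ℚ.* h ℚ.+ ((t ℚ.+ h) ℚ.* h ℚ.+ (t ℚ.+ h) ℚ.* h)
        ≡⟨ solve 2 (λ t h →
             (t :+ h) :* (t :+ h) :+ h :* h :+ ((t :+ h) :* h :+ (t :+ h) :* h)
             := (t :+ (h :+ h)) :* (t :+ (h :+ h))) refl t h ⟩
      (t ℚ.+ (h ℚ.+ h)) ℚ.* (t ℚ.+ (h ℚ.+ h))
        ≡⟨ cong (λ e → (t ℚ.+ e) ℚ.* (t ℚ.+ e)) (half+half ε) ⟩
      (t ℚ.+ ε) ℚ.* (t ℚ.+ ε) ∎

  square-pos : ∀ {p} → 0ℚ ℚ.< p → 0ℚ ℚ.< p ℚ.* p
  square-pos {p} 0<p = ℚ.positive⁻¹ (p ℚ.* p) {{ℚ.pos*pos⇒pos p p}}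
    where
    instance
      p>0 : ℚ.Positive p
      p>0 = ℚ.positive 0<p

  √-term : ∀ q i → ∃[ s ] (0ℚ ℚ.≤ s × s ℚ.* s ℚ.≤ ∣ q ∣
                          × ∣ q ∣ ℚ.< (s ℚ.+ δ i) ℚ.* (s ℚ.+ δ i))
  √-term q i = approxRoot (δ i) ∣ q ∣ (0<δ i) (ℚ.0≤∣p∣ q)

  √-terms-close : ∀ p q i j ε → 0ℚ ℚ.< ε → δ j ℚ.≤ ½ ℚ.* ε →
    ∣ p ℚ.- q ∣ ℚ.< (½ ℚ.* ε) ℚ.* (½ ℚ.* ε) →
    proj₁ (√-term p i) ℚ.< proj₁ (√-term q j) ℚ.+ ε
  √-terms-close p q i j ε 0<ε δ≤ p-q< =
    let s , _ , s²≤p , _ = √-term p i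
        t , 0≤t , _ , q<[t+δ]² = √-term q j
    in roots-close {∣ p ∣} {∣ q ∣} {δ j} {s} {t} ε 0<ε (0<δ j) δ≤ 0≤t s²≤p q<[t+δ]²
         (ℚ.≤-trans (∣p∣≤∣q∣+∣p-q∣ p q) (ℚ.+-monoʳ-≤ ∣ q ∣ (ℚ.<⇒≤ p-q<)))

abstract
  √-cauchy : ∀ x → IsCauchy (λ i → proj₁ (√-term (seq x i) i))
  √-cauchy x ε 0<ε =
    let M , small = δ-small (½ ℚ.* ε) (half-pos 0<ε)
        N , f = cauchy x ((½ ℚ.* ε) ℚ.* (½ ℚ.* ε)) (square-pos (half-pos 0<ε))
        close = λ i j i≥ j≥ → √-terms-close (seq x i) (seq x j) i j ε 0<ε
          (small j (ℕ.m⊔n≤o⇒m≤o M N j≥))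
          (f i j (ℕ.m⊔n≤o⇒n≤o M N i≥) (ℕ.m⊔n≤o⇒n≤o M N j≥))
    in M ℕ.⊔ N , λ i j i≥ j≥ →
      ∣p-q∣<ε {proj₁ (√-term (seq x i) i)} {proj₁ (√-term (seq x j) j)} {ε} (close i j i≥ j≥) (close j i j≥ i≥)

√_ : ℝ → ℝ
√ x = mkℝ (λ i → proj₁ (√-term (seq x i) i)) (√-cauchy x)

abstract
  √-nonneg : ∀ x → 0ℝ ≤ √ x
  √-nonneg x ε 0<ε = 0 , λ i _ → ℚ.+-mono-≤-< (proj₁ (proj₂ (√-term (seq x i) i))) 0<ε

private
  ∣p∣<p+ε : ∀ p ε → 0ℚ ℚ.< ε → 0ℚ ℚ.< p ℚ.+ ½ ℚ.* ε → ∣ p ∣ ℚ.< p ℚ.+ ε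
  ∣p∣<p+ε p ε 0<ε 0<p+h with ℚ.∣p∣≡p∨∣p∣≡-p p
  ... | inj₁ eq = subst (ℚ._< p ℚ.+ ε) (trans (ℚ.+-identityʳ p) (sym eq)) (ℚ.+-monoʳ-< p 0<ε)
  ... | inj₂ eq = subst₂ ℚ._<_
    (trans (ℚ.+-identityˡ (ℚ.- p)) (sym eq))
    (trans (solve 2 (λ p h → (p :+ h) :+ (p :+ h) :+ :- p := p :+ (h :+ h)) refl p (½ ℚ.* ε))
      (cong (p ℚ.+_) (half+half ε)))
    (ℚ.+-monoˡ-< (ℚ.- p) (ℚ.+-mono-< 0<p+h 0<p+h))
    where open +-*-Solver

  δ≤1 : ∀ i → δ i ℚ.≤ 1ℚ
  δ≤1 i = ℚ.*≤* (ℤ.+≤+ (subst (1 ℕ.≤_) (sym (ℕ.*-identityˡ (suc i))) (ℕ.s≤s ℕ.z≤n)))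

  [s+r]²≤s²+ε : ∀ {B η ε} s r → 0ℚ ℚ.≤ B ℚ.+ B ℚ.+ 1ℚ → (B ℚ.+ B ℚ.+ 1ℚ) ℚ.* η ≡ ε →
    s ℚ.≤ B → 0ℚ ℚ.≤ r → r ℚ.≤ 1ℚ → r ℚ.≤ η →
    (s ℚ.+ r) ℚ.* (s ℚ.+ r) ℚ.≤ s ℚ.* s ℚ.+ ε
  [s+r]²≤s²+ε {B} {η} {ε} s r 0≤C Cη≡ε s≤B 0≤r r≤1 r≤η = begin
    (s ℚ.+ r) ℚ.* (s ℚ.+ r)
      ≡⟨ solve 2 (λ s r → (s :+ r) :* (s :+ r) := s :* s :+ (s :+ s :+ r) :* r) refl s r ⟩
    s ℚ.* s ℚ.+ (s ℚ.+ s ℚ.+ r) ℚ.* r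
      ≤⟨ ℚ.+-monoʳ-≤ (s ℚ.* s) (ℚ.*-monoʳ-≤-nonNeg r {{ℚ.nonNegative 0≤r}}
           (ℚ.+-mono-≤ (ℚ.+-mono-≤ s≤B s≤B) r≤1)) ⟩
    s ℚ.* s ℚ.+ (B ℚ.+ B ℚ.+ 1ℚ) ℚ.* r
      ≤⟨ ℚ.+-monoʳ-≤ (s ℚ.* s) (ℚ.*-monoˡ-≤-nonNeg (B ℚ.+ B ℚ.+ 1ℚ)
           {{ℚ.nonNegative 0≤C}} r≤η) ⟩
    s ℚ.* s ℚ.+ (B ℚ.+ B ℚ.+ 1ℚ) ℚ.* η
      ≡⟨ cong (s ℚ.* s ℚ.+_) Cη≡ε ⟩
    s ℚ.* s ℚ.+ ε ∎
    where
    open +-*-Solver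
    open ℚ.≤-Reasoning

abstract
  √-square : ∀ x → 0ℝ ≤ x → √ x * √ x ≈ x
  √-square x 0≤x = below , above
    where
    below : √ x * √ x ≤ x
    below ε 0<ε =
      let N , f = 0≤x (½ ℚ.* ε) (half-pos 0<ε)
      in N , λ i i≥ → ℚ.≤-<-trans (proj₁ (proj₂ (proj₂ (√-term (seq x i) i))))
                        (∣p∣<p+ε (seq x i) ε 0<ε (f i i≥))
    above : x ≤ √ x * √ x
    above ε 0<ε =
      let B , M , 0<B , bound = bounded (√ x)
          0<C = ℚ.+-mono-< (ℚ.+-mono-< 0<B 0<B) (ℚ.positive⁻¹ 1ℚ)
          η , 0<η , Cη≡ε = quotient (B ℚ.+ B ℚ.+ 1ℚ) ε 0<C 0<ε
          N , small = δ-small η 0<η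
      in M ℕ.⊔ N , λ i i≥ →
        let s = seq (√ x) i
            s≤B = ℚ.<⇒≤ (ℚ.≤-<-trans (p≤∣p∣ s) (bound i (ℕ.m⊔n≤o⇒m≤o M N i≥)))
        in ℚ.≤-<-trans (p≤∣p∣ (seq x i))
             (ℚ.<-≤-trans (proj₂ (proj₂ (proj₂ (√-term (seq x i) i))))
               ([s+r]²≤s²+ε s (δ i) (ℚ.<⇒≤ 0<C) Cη≡ε s≤B (ℚ.<⇒≤ (0<δ i)) (δ≤1 i)
                 (small i (ℕ.m⊔n≤o⇒n≤o M N i≥))))

Point : ℕ → Set
Point m = Vector ℝ m

sum : ∀ {m} → Vector ℝ m → ℝ
sum = foldr _+_ 0ℝ

⟨_,_⟩ : ∀ {m} → Point m → Point m → ℝ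
⟨ p , q ⟩ = sum (zipWith _*_ p q)

dist : ∀ {m} → Point m → Point m → ℝ
dist p q = √ ⟨ zipWith _-_ p q , zipWith _-_ p q ⟩

record Hyperplane (m : ℕ) : Set where
  field
    normal   : Point m
    offset   : ℝ
    normal≉0 : ¬ (∀ k → normal k ≈ 0ℝ)

_∈_ : ∀ {m} → Point m → Hyperplane m → Set
p ∈ H = ⟨ normal , p ⟩ ≈ offset
  where open Hyperplane H

record IntegralPointSet (m n : ℕ) : Set where
  field
    point    : Fin n → Point m
    distinct : ∀ i j → i ≢ j → ¬ (∀ k → point i k ≈ point j k)
    integral : ∀ i j → ∃[ z ] dist (point i) (point j) ≈ fromℤ z
    full     : ∀ (H : Hyperplane m) → ¬ (∀ i → point i ∈ H)

open IntegralPointSet public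

IsDiameter : ∀ {m n} → IntegralPointSet m n → ℝ → Set
IsDiameter P diam = (∀ i j → dist (point P i) (point P j) ≤ diam)
                  × ∃[ i ] ∃[ j ] dist (point P i) (point P j) ≈ diam

-- IsMinDiameter m n d says d(m, n) = d. It is a relation because a minimum of a
-- set of integers is not constructively available in general.

IsMinDiameter : ℕ → ℕ → ℝ → Set
IsMinDiameter m n d = (∃[ P ] IsDiameter {m} {n} P d)
                    × (∀ P diam → IsDiameter {m} {n} P diam → d ≤ diam)

-- d(m, n) ≤ b. Classically either field implies the other. Constructively
-- witness supplies a point set but no minimum, and in general the existence of a
-- minimum of an inhabited set of natural numbers only holds doubly negated.

record d⟨_,_⟩≤_ (m n : ℕ) (b : ℝ) : Set where
  field
    witness : ∃[ P ] ∃[ diam ] (IsDiameter {m} {n} P diam × diam ≤ b)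
    minimum : ¬ ¬ (∃[ d ] (IsMinDiameter m n d × d ≤ b))

-- Stack four copies of the regular simplex with m vertices and edge length 120
-- in parallel hyperplanes at the heights 0, 182, 209, 391. Every difference
-- 27, 182, 209, 391 of heights is a leg of a right triangle whose other leg is
-- 120, with hypotenuse 123, 218, 241, 409, so all distances are integers.
-- In coordinates a vertex is s eᵢ + h r (1, …, 1) with s² = 7200 and r² = 1/m:
-- the distance of eᵢ and eⱼ is √2 and the length of (1, …, 1) is √m.

module Submission where

open import Defs
open import Data.Nat as ℕ using (ℕ; zero; suc)
import Data.Nat.Properties as ℕ
open import Data.Nat.Induction using (<-rec)
open import Data.Nat.Coprimality using (1-coprimeTo) renaming (sym to coprime-sym)
open import Data.Integer as ℤ using (ℤ; +_; -[1+_])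
import Data.Integer.Properties as ℤ
open import Data.Rational as ℚ using (ℚ; mkℚ; 0ℚ; 1ℚ; ½; ∣_∣)
import Data.Rational.Properties as ℚ
open import Data.Rational.Solver using (module +-*-Solver)
open import Data.Bool using (Bool; true; false; if_then_else_)
open import Data.Fin using (Fin; zero; suc; _≟_; remQuot; combine)
open import Data.Fin.Properties using (all?; remQuot-combine; combine-remQuot)
open import Data.Vec as Vec using ([]; _∷_)
open import Data.Vec.Functional using (Vector; zipWith)
open import Data.Product using (∃-syntax; _×_; _,_; proj₁; proj₂; uncurry)
open import Data.Sum using (inj₁; inj₂)
open import Algebra.Bundles using (CommutativeRing; Semiring)
import Algebra.Properties.Semiring.Sum as SemiringSum
import Algebra.Properties.Group as GroupProperties
import Relation.Binary.Reasoning.Setoid as SetoidReasoning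
open import Level using (Level)
open import Relation.Binary.PropositionalEquality
  using (_≡_; _≢_; refl; sym; trans; cong; cong₂; subst; subst₂; module ≡-Reasoning)
open import Relation.Nullary using (¬_; yes; no; does; contradiction)
open import Relation.Nullary.Decidable using (from-yes; ¬?; _→-dec_)

-- Real numbers

private
  half-pos : ∀ {ε} → 0ℚ ℚ.< ε → 0ℚ ℚ.< ½ ℚ.* ε
  half-pos {ε} 0<ε = ℚ.positive⁻¹ (½ ℚ.* ε) {{ℚ.pos*pos⇒pos ½ ε {{ℚ.positive 0<ε}}}}

  half+half : ∀ ε → ½ ℚ.* ε ℚ.+ ½ ℚ.* ε ≡ ε
  half+half ε = trans (sym (ℚ.*-distribʳ-+ ε ½ ½)) (ℚ.*-identityˡ ε)

  p≤∣p∣ : ∀ p → p ℚ.≤ ∣ p ∣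
  p≤∣p∣ p with ℚ.≤-total 0ℚ p
  ... | inj₁ 0≤p = ℚ.≤-reflexive (sym (ℚ.0≤p⇒∣p∣≡p 0≤p))
  ... | inj₂ p≤0 = ℚ.≤-trans p≤0 (ℚ.0≤∣p∣ p)

  <⇒0<- : ∀ {p q} → p ℚ.< q → 0ℚ ℚ.< q ℚ.- p
  <⇒0<- {p} {q} p<q = subst (ℚ._< q ℚ.- p) (ℚ.+-inverseʳ p) (ℚ.+-monoˡ-< (ℚ.- p) p<q)

  p+[q-p]≡q : ∀ p q → p ℚ.+ (q ℚ.- p) ≡ q
  p+[q-p]≡q = solve 2 (λ p q → p :+ (q :- p) := q) refl
    where open +-*-Solver

  quotient : ∀ B ε → 0ℚ ℚ.< B → 0ℚ ℚ.< ε → ∃[ η ] (0ℚ ℚ.< η × B ℚ.* η ≡ ε)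
  quotient B ε 0<B 0<ε =
    (ℚ.1/ B) ℚ.* ε
    , ℚ.positive⁻¹ ((ℚ.1/ B) ℚ.* ε)
        {{ℚ.pos*pos⇒pos (ℚ.1/ B) {{ℚ.1/pos⇒pos B}} ε {{ℚ.positive 0<ε}}}}
    , trans (sym (ℚ.*-assoc B (ℚ.1/ B) ε))
        (trans (cong (ℚ._* ε) (ℚ.*-inverseʳ B)) (ℚ.*-identityˡ ε))
    where
    instance
      B>0 : ℚ.Positive B
      B>0 = ℚ.positive 0<B
      B≢0 : ℚ.NonZero B
      B≢0 = ℚ.pos⇒nonZero B

  product-small : ∀ {B η} p q → 0ℚ ℚ.< B → ∣ p ∣ ℚ.≤ B → ∣ q ∣ ℚ.< η → ∣ p ℚ.* q ∣ ℚ.< B ℚ.* η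
  product-small {B} {η} p q 0<B p≤B q<η = begin-strict
    ∣ p ℚ.* q ∣     ≡⟨ ℚ.∣p*q∣≡∣p∣*∣q∣ p q ⟩
    ∣ p ∣ ℚ.* ∣ q ∣ ≤⟨ ℚ.*-monoʳ-≤-nonNeg ∣ q ∣ {{ℚ.nonNegative (ℚ.0≤∣p∣ q)}} p≤B ⟩
    B ℚ.* ∣ q ∣     <⟨ ℚ.*-monoʳ-<-pos B {{ℚ.positive 0<B}} q<η ⟩
    B ℚ.* η         ∎
    where open ℚ.≤-Reasoning

-- Order and equality of real numbers

≤-refl : ∀ {x} → x ≤ x
≤-refl {x} ε 0<ε = 0 , λ i _ →
  subst (ℚ._< seq x i ℚ.+ ε) (ℚ.+-identityʳ (seq x i)) (ℚ.+-monoʳ-< (seq x i) 0<ε)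

≤-trans : ∀ {x y z} → x ≤ y → y ≤ z → x ≤ z
≤-trans {x} {y} {z} x≤y y≤z ε 0<ε =
  let M , f = x≤y (½ ℚ.* ε) (half-pos 0<ε)
      N , g = y≤z (½ ℚ.* ε) (half-pos 0<ε)
  in M ℕ.⊔ N , λ i i≥ → subst (seq x i ℚ.<_)
       (trans (ℚ.+-assoc (seq z i) (½ ℚ.* ε) (½ ℚ.* ε)) (cong (seq z i ℚ.+_) (half+half ε)))
       (ℚ.<-trans (f i (ℕ.m⊔n≤o⇒m≤o M N i≥))
                  (ℚ.+-monoˡ-< (½ ℚ.* ε) (g i (ℕ.m⊔n≤o⇒n≤o M N i≥))))

+-mono-≤ : ∀ {x y u v} → x ≤ y → u ≤ v → x + u ≤ y + v
+-mono-≤ {x} {y} {u} {v} x≤y u≤v ε 0<ε =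
  let M , f = x≤y (½ ℚ.* ε) (half-pos 0<ε)
      N , g = u≤v (½ ℚ.* ε) (half-pos 0<ε)
  in M ℕ.⊔ N , λ i i≥ → subst (seq x i ℚ.+ seq u i ℚ.<_)
       (trans (rearrange (seq y i) (seq v i) (½ ℚ.* ε))
         (cong (seq y i ℚ.+ seq v i ℚ.+_) (half+half ε)))
       (ℚ.+-mono-< (f i (ℕ.m⊔n≤o⇒m≤o M N i≥)) (g i (ℕ.m⊔n≤o⇒n≤o M N i≥)))
  where
  open +-*-Solver
  rearrange : ∀ a b h → (a ℚ.+ h) ℚ.+ (b ℚ.+ h) ≡ (a ℚ.+ b) ℚ.+ (h ℚ.+ h)
  rearrange = solve 3 (λ a b h → (a :+ h) :+ (b :+ h) := (a :+ b) :+ (h :+ h)) refl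

neg-antimono-≤ : ∀ {x y} → x ≤ y → - y ≤ - x
neg-antimono-≤ {x} {y} x≤y ε 0<ε with N , f ← x≤y ε 0<ε =
  N , λ i i≥ → subst₂ ℚ._<_ (left (seq x i) (seq y i)) (right (seq x i) (seq y i) ε)
    (ℚ.+-monoˡ-< (ℚ.- seq x i ℚ.- seq y i) (f i i≥))
  where
  open +-*-Solver
  left : ∀ a b → a ℚ.+ (ℚ.- a ℚ.- b) ≡ ℚ.- b
  left = solve 2 (λ a b → a :+ (:- a :- b) := :- b) refl
  right : ∀ a b e → (b ℚ.+ e) ℚ.+ (ℚ.- a ℚ.- b) ≡ ℚ.- a ℚ.+ e
  right = solve 3 (λ a b e → (b :+ e) :+ (:- a :- b) := :- a :+ e) refl

≈-pointwise : ∀ {x y} → (∀ i → seq x i ≡ seq y i) → x ≈ y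
≈-pointwise {x} {y} eq = below , above
  where
  below : x ≤ y
  below ε 0<ε with N , f ← ≤-refl {x} ε 0<ε =
    N , λ i i≥ → subst (λ t → seq x i ℚ.< t ℚ.+ ε) (eq i) (f i i≥)
  above : y ≤ x
  above ε 0<ε with N , f ← ≤-refl {x} ε 0<ε =
    N , λ i i≥ → subst (λ t → t ℚ.< seq x i ℚ.+ ε) (eq i) (f i i≥)

≈-refl : ∀ {x} → x ≈ x
≈-refl {x} = ≤-refl {x} , ≤-refl {x}

≈-sym : ∀ {x y} → x ≈ y → y ≈ x
≈-sym (x≤y , y≤x) = y≤x , x≤y

≈-trans : ∀ {x y z} → x ≈ y → y ≈ z → x ≈ z
≈-trans {x} {y} {z} (x≤y , y≤x) (y≤z , z≤y) =
  ≤-trans {x} {y} {z} x≤y y≤z , ≤-trans {z} {y} {x} z≤y y≤x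

-- Together with `small⇒≈0`, this trades the two one-sided estimates in `_≈_` for a single one on
-- absolute values, which behaves well under products.
≈0⇒small : ∀ {x} → x ≈ 0ℝ → ∀ ε → 0ℚ ℚ.< ε → ∃[ N ] ∀ i → N ℕ.≤ i → ∣ seq x i ∣ ℚ.< ε
≈0⇒small {x} (x≤0 , 0≤x) ε 0<ε =
  let M , f = x≤0 ε 0<ε
      N , g = 0≤x ε 0<ε
  in M ℕ.⊔ N , λ i i≥ → small (seq x i) (f i (ℕ.m⊔n≤o⇒m≤o M N i≥)) (g i (ℕ.m⊔n≤o⇒n≤o M N i≥))
  where
  small : ∀ p → p ℚ.< 0ℚ ℚ.+ ε → 0ℚ ℚ.< p ℚ.+ ε → ∣ p ∣ ℚ.< ε
  small p p<ε 0<p+ε with ℚ.∣p∣≡p∨∣p∣≡-p p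
  ... | inj₁ eq = subst₂ ℚ._<_ (sym eq) (ℚ.+-identityˡ ε) p<ε
  ... | inj₂ eq = subst₂ ℚ._<_ (trans (ℚ.+-identityˡ (ℚ.- p)) (sym eq))
    (solve 2 (λ p e → (p :+ e) :- p := e) refl p ε) (ℚ.+-monoˡ-< (ℚ.- p) 0<p+ε)
    where open +-*-Solver

small⇒≈0 : ∀ {x} → (∀ ε → 0ℚ ℚ.< ε → ∃[ N ] ∀ i → N ℕ.≤ i → ∣ seq x i ∣ ℚ.< ε) → x ≈ 0ℝ
small⇒≈0 {x} small = below , above
  where
  below : x ≤ 0ℝ
  below ε 0<ε with N , f ← small ε 0<ε = N , λ i i≥ →
    subst (seq x i ℚ.<_) (sym (ℚ.+-identityˡ ε)) (ℚ.≤-<-trans (p≤∣p∣ (seq x i)) (f i i≥))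
  above : 0ℝ ≤ x
  above ε 0<ε with N , f ← small ε 0<ε = N , λ i i≥ →
    subst (ℚ._< seq x i ℚ.+ ε) (ℚ.+-inverseʳ (seq x i)) (ℚ.+-monoʳ-< (seq x i)
      (ℚ.≤-<-trans (p≤∣p∣ (ℚ.- seq x i)) (subst (ℚ._< ε) (sym (ℚ.∣-p∣≡∣p∣ (seq x i))) (f i i≥))))

eventually-bounded : ∀ x → ∃[ B ] ∃[ N ] (0ℚ ℚ.< B × (∀ i → N ℕ.≤ i → ∣ seq x i ∣ ℚ.≤ B))
eventually-bounded x with N , f ← cauchy x 1ℚ (ℚ.positive⁻¹ 1ℚ) =
  B , N , ℚ.+-mono-≤-< (ℚ.0≤∣p∣ (seq x N)) (ℚ.positive⁻¹ 1ℚ) , λ i i≥ → begin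
    ∣ seq x i ∣                            ≡⟨ cong ∣_∣ (p+[q-p]≡q (seq x N) (seq x i)) ⟨
    ∣ seq x N ℚ.+ (seq x i ℚ.- seq x N) ∣  ≤⟨ ℚ.∣p+q∣≤∣p∣+∣q∣ (seq x N) _ ⟩
    ∣ seq x N ∣ ℚ.+ ∣ seq x i ℚ.- seq x N ∣ ≤⟨ ℚ.+-monoʳ-≤ ∣ seq x N ∣ (ℚ.<⇒≤ (f i N i≥ ℕ.≤-refl)) ⟩
    B                                      ∎
  where
  open ℚ.≤-Reasoning
  B : ℚ
  B = ∣ seq x N ∣ ℚ.+ 1ℚ

-- A Cauchy sequence is bounded from some index on, and a bounded sequence times a null sequence is
-- null.
x*0≈0 : ∀ x {y} → y ≈ 0ℝ → x * y ≈ 0ℝ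
x*0≈0 x {y} y≈0 = small⇒≈0 {x * y} small
  where
  small : ∀ ε → 0ℚ ℚ.< ε → ∃[ N ] ∀ i → N ℕ.≤ i → ∣ seq x i ℚ.* seq y i ∣ ℚ.< ε
  small ε 0<ε =
    let B , M , 0<B , bound = eventually-bounded x
        η , 0<η , Bη≡ε = quotient B ε 0<B 0<ε
        N , f = ≈0⇒small {y} y≈0 η 0<η
    in M ℕ.⊔ N , λ i i≥ → subst (∣ seq x i ℚ.* seq y i ∣ ℚ.<_) Bη≡ε
         (product-small (seq x i) (seq y i) 0<B
           (bound i (ℕ.m⊔n≤o⇒m≤o M N i≥)) (f i (ℕ.m⊔n≤o⇒n≤o M N i≥)))

+-cong : ∀ {x y u v} → x ≈ y → u ≈ v → x + u ≈ y + v
+-cong {x} {y} {u} {v} (x≤y , y≤x) (u≤v , v≤u) =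
  +-mono-≤ {x} {y} {u} {v} x≤y u≤v , +-mono-≤ {y} {x} {v} {u} y≤x v≤u

neg-cong : ∀ {x y} → x ≈ y → - x ≈ - y
neg-cong {x} {y} (x≤y , y≤x) = neg-antimono-≤ {y} {x} y≤x , neg-antimono-≤ {x} {y} x≤y

*-comm : ∀ x y → x * y ≈ y * x
*-comm x y = ≈-pointwise {x * y} {y * x} λ i → ℚ.*-comm (seq x i) (seq y i)

-- Writing `x * y` as `x * (y - z) + x * z` reduces the claim to a product with a null sequence.
*-congˡ : ∀ x {y z} → y ≈ z → x * y ≈ x * z
*-congˡ x {y} {z} y≈z = ≈-trans {x * y} {x * (y - z) + x * z} {x * z}
  (≈-pointwise {x * y} {x * (y - z) + x * z} λ i → split (seq x i) (seq y i) (seq z i))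
  (≈-trans {x * (y - z) + x * z} {0ℝ + x * z} {x * z}
    (+-cong {x * (y - z)} {0ℝ} {x * z} {x * z} (x*0≈0 x {y - z} y-z≈0) (≈-refl {x * z}))
    (≈-pointwise {0ℝ + x * z} {x * z} λ i → ℚ.+-identityˡ (seq x i ℚ.* seq z i)))
  where
  open +-*-Solver
  split : ∀ a b c → a ℚ.* b ≡ a ℚ.* (b ℚ.- c) ℚ.+ a ℚ.* c
  split = solve 3 (λ a b c → a :* b := a :* (b :- c) :+ a :* c) refl
  y-z≈0 : y - z ≈ 0ℝ
  y-z≈0 = ≈-trans {y - z} {z - z} {0ℝ}
    (+-cong {y} {z} { - z} { - z} y≈z (≈-refl { - z}))
    (≈-pointwise {z - z} {0ℝ} λ i → ℚ.+-inverseʳ (seq z i))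

*-cong : ∀ {x y u v} → x ≈ y → u ≈ v → x * u ≈ y * v
*-cong {x} {y} {u} {v} x≈y u≈v = ≈-trans {x * u} {x * v} {y * v} (*-congˡ x {u} {v} u≈v)
  (≈-trans {x * v} {v * x} {y * v} (*-comm x v)
    (≈-trans {v * x} {v * y} {y * v} (*-congˡ v {x} {y} x≈y) (*-comm v y)))

-- The ring laws hold term by term in ℚ; only the congruences rest on estimates.
ℝ-commutativeRing : CommutativeRing _ _
ℝ-commutativeRing = record
  { Carrier = ℝ ; _≈_ = _≈_ ; _+_ = _+_ ; _*_ = _*_ ; -_ = -_ ; 0# = 0ℝ ; 1# = fromℚ 1ℚ
  ; isCommutativeRing = record
    { isRing = record
      { +-isAbelianGroup = record
        { isGroup = record
          { isMonoid = record
            { isSemigroup = record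
              { isMagma = record
                { isEquivalence = record
                  { refl = λ {x} → ≈-refl {x}
                  ; sym = λ {x} {y} → ≈-sym {x} {y}
                  ; trans = λ {x} {y} {z} → ≈-trans {x} {y} {z} }
                ; ∙-cong = λ {x} {y} {u} {v} → +-cong {x} {y} {u} {v} }
              ; assoc = λ x y z → ≈-pointwise {x + y + z} {x + (y + z)} λ i → ℚ.+-assoc (seq x i) (seq y i) (seq z i) }
            ; identity = (λ x → ≈-pointwise {0ℝ + x} {x} λ i → ℚ.+-identityˡ (seq x i))
                       , (λ x → ≈-pointwise {x + 0ℝ} {x} λ i → ℚ.+-identityʳ (seq x i)) }
          ; inverse = (λ x → ≈-pointwise { - x + x} {0ℝ} λ i → ℚ.+-inverseˡ (seq x i))
                    , (λ x → ≈-pointwise {x - x} {0ℝ} λ i → ℚ.+-inverseʳ (seq x i))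
          ; ⁻¹-cong = λ {x} {y} → neg-cong {x} {y} }
        ; comm = λ x y → ≈-pointwise {x + y} {y + x} λ i → ℚ.+-comm (seq x i) (seq y i) }
      ; *-cong = λ {x} {y} {u} {v} → *-cong {x} {y} {u} {v}
      ; *-assoc = λ x y z → ≈-pointwise {x * y * z} {x * (y * z)} λ i → ℚ.*-assoc (seq x i) (seq y i) (seq z i)
      ; *-identity = (λ x → ≈-pointwise {fromℚ 1ℚ * x} {x} λ i → ℚ.*-identityˡ (seq x i))
                   , (λ x → ≈-pointwise {x * fromℚ 1ℚ} {x} λ i → ℚ.*-identityʳ (seq x i))
      ; distrib = (λ x y z → ≈-pointwise {x * (y + z)} {x * y + x * z} λ i → ℚ.*-distribˡ-+ (seq x i) (seq y i) (seq z i))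
                , (λ x y z → ≈-pointwise {(y + z) * x} {y * x + z * x} λ i → ℚ.*-distribʳ-+ (seq x i) (seq y i) (seq z i)) }
    ; *-comm = *-comm } }

-- Let `h` be half of `ε`. If a term of `x` exceeded that of `y` by `ε` or more while the latter is
-- above `-ε/4`, then the sum of the two terms would be at least `h`, and the difference of their
-- squares, as a product of difference and sum, at least `ε h`. This contradicts the hypothesis with
-- tolerance `ε h`.
square-cancel-≤ : ∀ {x y} → 0ℝ ≤ y → x * x ≤ y * y → x ≤ y
square-cancel-≤ {x} {y} 0≤y x²≤y² ε 0<ε =
  let M , f = 0≤y (½ ℚ.* h) (half-pos (half-pos 0<ε))
      N , g = x²≤y² (ε ℚ.* h) (ℚ.positive⁻¹ _ {{ℚ.pos*pos⇒pos ε h}})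
  in M ℕ.⊔ N , λ i i≥ → ℚ.≰⇒> (λ y+ε≤x → ℚ.<-irrefl refl
       (ℚ.<-≤-trans (g i (ℕ.m⊔n≤o⇒n≤o M N i≥))
                    (far (seq x i) (seq y i) (f i (ℕ.m⊔n≤o⇒m≤o M N i≥)) y+ε≤x)))
  where
  h : ℚ
  h = ½ ℚ.* ε
  instance
    ε>0 : ℚ.Positive ε
    ε>0 = ℚ.positive 0<ε
    h>0 : ℚ.Positive h
    h>0 = ℚ.positive (half-pos 0<ε)
  far : ∀ a b → 0ℚ ℚ.< b ℚ.+ ½ ℚ.* h → b ℚ.+ ε ℚ.≤ a → b ℚ.* b ℚ.+ ε ℚ.* h ℚ.≤ a ℚ.* a
  far a b 0<b+½h b+ε≤a = begin
    b ℚ.* b ℚ.+ ε ℚ.* h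
      ≤⟨ ℚ.+-monoʳ-≤ (b ℚ.* b) (ℚ.*-monoˡ-≤-nonNeg ε {{ℚ.pos⇒nonNeg ε}} h≤a+b) ⟩
    b ℚ.* b ℚ.+ ε ℚ.* (a ℚ.+ b)
      ≤⟨ ℚ.+-monoʳ-≤ (b ℚ.* b) (ℚ.*-monoʳ-≤-nonNeg (a ℚ.+ b) {{ℚ.nonNegative 0≤a+b}} ε≤a-b) ⟩
    b ℚ.* b ℚ.+ (a ℚ.- b) ℚ.* (a ℚ.+ b)
      ≡⟨ solve 2 (λ a b → b :* b :+ (a :- b) :* (a :+ b) := a :* a) refl a b ⟩
    a ℚ.* a ∎
    where
    open +-*-Solver
    open ℚ.≤-Reasoning
    ε≤a-b : ε ℚ.≤ a ℚ.- b
    ε≤a-b = subst (ℚ._≤ a ℚ.- b)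
      (solve 2 (λ b e → (b :+ e) :- b := e) refl b ε) (ℚ.+-monoˡ-≤ (ℚ.- b) b+ε≤a)
    h≤a+b : h ℚ.≤ a ℚ.+ b
    h≤a+b = begin
      h ≡⟨ ℚ.+-identityʳ h ⟨
      h ℚ.+ (0ℚ ℚ.+ 0ℚ) ≤⟨ ℚ.+-monoʳ-≤ h (ℚ.+-mono-≤ (ℚ.<⇒≤ 0<b+½h) (ℚ.<⇒≤ 0<b+½h)) ⟩
      h ℚ.+ ((b ℚ.+ ½ ℚ.* h) ℚ.+ (b ℚ.+ ½ ℚ.* h))
        ≡⟨ solve 3 (λ h b q → h :+ ((b :+ q) :+ (b :+ q)) := b :+ (h :+ (q :+ q)) :+ b) refl h b (½ ℚ.* h) ⟩
      b ℚ.+ (h ℚ.+ (½ ℚ.* h ℚ.+ ½ ℚ.* h)) ℚ.+ b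
        ≡⟨ cong (λ t → b ℚ.+ t ℚ.+ b) (trans (cong (h ℚ.+_) (half+half h)) (half+half ε)) ⟩
      b ℚ.+ ε ℚ.+ b ≤⟨ ℚ.+-monoˡ-≤ b b+ε≤a ⟩
      a ℚ.+ b ∎
    0≤a+b : 0ℚ ℚ.≤ a ℚ.+ b
    0≤a+b = ℚ.≤-trans (ℚ.<⇒≤ (half-pos 0<ε)) h≤a+b

-- Rational and integer constants, square roots

fromℚ-mono-≤ : ∀ {p q} → p ℚ.≤ q → fromℚ p ≤ fromℚ q
fromℚ-mono-≤ {p} {q} p≤q ε 0<ε = 0 , λ _ _ →
  subst (ℚ._< q ℚ.+ ε) (ℚ.+-identityʳ p) (ℚ.+-mono-≤-< p≤q 0<ε)

fromℚ-cancel-≤ : ∀ {p q} → fromℚ p ≤ fromℚ q → p ℚ.≤ q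
fromℚ-cancel-≤ {p} {q} p≤q = ℚ.≮⇒≥ λ q<p →
  -- With the supposed gap `p - q` as tolerance, the hypothesis reads `p < p`.
  let N , f = p≤q (p ℚ.- q) (<⇒0<- q<p)
  in ℚ.<-irrefl (sym (p+[q-p]≡q q p)) (f N ℕ.≤-refl)

private
  -- The fraction `k ℚ./ 1` hides its numerator behind a normalisation by the gcd; this form exposes
  -- numerator and denominator.
  integer : ℤ → ℚ
  integer k = mkℚ k 0 (coprime-sym (1-coprimeTo ℤ.∣ k ∣))

  k/1≡integer : ∀ k → k ℚ./ 1 ≡ integer k
  k/1≡integer k = ℚ.fromℚᵘ-toℚᵘ (integer k)

fromℤ-mono-≤ : ∀ {a b} → a ℤ.≤ b → fromℤ a ≤ fromℤ b
fromℤ-mono-≤ {a} {b} a≤b = fromℚ-mono-≤ (subst₂ ℚ._≤_ (sym (k/1≡integer a)) (sym (k/1≡integer b))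
  (ℚ.*≤* (subst₂ ℤ._≤_ (sym (ℤ.*-identityʳ a)) (sym (ℤ.*-identityʳ b)) a≤b)))

fromℤ-cancel-≤ : ∀ {a b} → fromℤ a ≤ fromℤ b → a ℤ.≤ b
fromℤ-cancel-≤ {a} {b} a≤b = subst₂ ℤ._≤_ (ℤ.*-identityʳ a) (ℤ.*-identityʳ b)
  (ℚ.drop-*≤* (subst₂ ℚ._≤_ (k/1≡integer a) (k/1≡integer b) (fromℚ-cancel-≤ a≤b)))

fromℚ-cancel-* : ∀ {q} .{{_ : ℚ.NonZero q}} {x} → fromℚ q * x ≈ 0ℝ → x ≈ 0ℝ
fromℚ-cancel-* {q} {x} qx≈0 = ≈-trans {x} {fromℚ (ℚ.1/ q) * (fromℚ q * x)} {0ℝ}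
  (≈-pointwise {x} {fromℚ (ℚ.1/ q) * (fromℚ q * x)} λ i → sym (trans
    (sym (ℚ.*-assoc (ℚ.1/ q) q (seq x i)))
    (trans (cong (ℚ._* seq x i) (ℚ.*-inverseˡ q)) (ℚ.*-identityˡ (seq x i)))))
  (x*0≈0 (fromℚ (ℚ.1/ q)) {fromℚ q * x} qx≈0)

√-unique : ∀ {x y} → 0ℝ ≤ x → 0ℝ ≤ y → x ≈ y * y → √ x ≈ y
√-unique {x} {y} 0≤x 0≤y x≈y² = square-cancel-≤ {√ x} {y} 0≤y (proj₁ √x²≈y²)
                              , square-cancel-≤ {y} {√ x} (√-nonneg x) (proj₂ √x²≈y²)
  where
  √x²≈y² : √ x * √ x ≈ y * y
  √x²≈y² = ≈-trans {√ x * √ x} {x} {y * y} (√-square x 0≤x) x≈y²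

-- A second multiplication by the root turns the factor into the rational `q`, so only a rational
-- number has to be inverted.
√-cancel-* : ∀ {q} .{{_ : ℚ.Positive q}} {x} → √ fromℚ q * x ≈ 0ℝ → x ≈ 0ℝ
√-cancel-* {q} {x} √q*x≈0 = fromℚ-cancel-* {q} {{ℚ.pos⇒nonZero q}} {x}
  (≈-trans {fromℚ q * x} {r * r * x} {0ℝ}
    (*-cong {fromℚ q} {r * r} {x} {x} (≈-sym {r * r} {fromℚ q} r²≈q) (≈-refl {x}))
    (≈-trans {r * r * x} {r * (r * x)} {0ℝ}
      (≈-pointwise {r * r * x} {r * (r * x)} λ i → ℚ.*-assoc (seq r i) (seq r i) (seq x i))
      (x*0≈0 r {r * x} √q*x≈0)))
  where
  r : ℝ
  r = √ fromℚ q
  r²≈q : r * r ≈ fromℚ q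
  r²≈q = √-square (fromℚ q) (fromℚ-mono-≤ (ℚ.<⇒≤ (ℚ.positive⁻¹ q)))

-- Sums over the coordinates of a vertex

ℚ-semiring : Semiring _ _
ℚ-semiring = CommutativeRing.semiring ℚ.+-*-commutativeRing

open SemiringSum ℚ-semiring using (∑-distrib-+; sum-cong-≗; *-distribˡ-sum) renaming (sum to sumℚ)

indicator : Bool → ℚ
indicator b = if b then 1ℚ else 0ℚ

-- The standard basis vector eᵢ. It passes through the Boolean `does (i ≟ k)` because the same
-- Boolean later selects the case in `prismDist`.
kronecker : ∀ {m} → Fin m → Vector ℚ m
kronecker i k = indicator (does (i ≟ k))

kronecker-diagonal : ∀ {m} (i : Fin m) → kronecker i i ≡ 1ℚ
kronecker-diagonal zero = refl
kronecker-diagonal (suc i) = kronecker-diagonal i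

kronecker-sym : ∀ {m} (i j : Fin m) → kronecker i j ≡ kronecker j i
kronecker-sym zero zero = refl
kronecker-sym zero (suc j) = refl
kronecker-sym (suc i) zero = refl
kronecker-sym (suc i) (suc j) = kronecker-sym i j

sum-kronecker : ∀ {m} (f : Vector ℚ m) i → sumℚ (λ k → kronecker i k ℚ.* f k) ≡ f i
sum-kronecker {suc m} f zero = begin
  1ℚ ℚ.* f zero ℚ.+ sumℚ (λ k → 0ℚ ℚ.* f (suc k))
    ≡⟨ cong₂ ℚ._+_ (ℚ.*-identityˡ (f zero)) (sym (*-distribˡ-sum 0ℚ (λ k → f (suc k)))) ⟩
  f zero ℚ.+ 0ℚ ℚ.* sumℚ (λ k → f (suc k))
    ≡⟨ cong (f zero ℚ.+_) (ℚ.*-zeroˡ (sumℚ (λ k → f (suc k)))) ⟩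
  f zero ℚ.+ 0ℚ
    ≡⟨ ℚ.+-identityʳ (f zero) ⟩
  f zero ∎
  where open ≡-Reasoning
sum-kronecker {suc m} f (suc i) = trans
  (cong₂ ℚ._+_ (ℚ.*-zeroˡ (f zero)) (sum-kronecker (λ k → f (suc k)) i))
  (ℚ.+-identityˡ (f (suc i)))

sum-linear : ∀ {m} a b (f g : Vector ℚ m) →
  sumℚ (λ k → a ℚ.* f k ℚ.+ b ℚ.* g k) ≡ a ℚ.* sumℚ f ℚ.+ b ℚ.* sumℚ g
sum-linear a b f g = trans (∑-distrib-+ (λ k → a ℚ.* f k) (λ k → b ℚ.* g k))
  (cong₂ ℚ._+_ (sym (*-distribˡ-sum a f)) (sym (*-distribˡ-sum b g)))

sum-difference : ∀ {m} (f g : Vector ℚ m) → sumℚ (λ k → f k ℚ.- g k) ≡ sumℚ f ℚ.- sumℚ g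
sum-difference f g = begin
  sumℚ (λ k → f k ℚ.- g k)                       ≡⟨ sum-cong-≗ (λ k → scale (f k) (g k)) ⟩
  sumℚ (λ k → 1ℚ ℚ.* f k ℚ.+ (ℚ.- 1ℚ) ℚ.* g k)   ≡⟨ sum-linear 1ℚ (ℚ.- 1ℚ) f g ⟩
  1ℚ ℚ.* sumℚ f ℚ.+ (ℚ.- 1ℚ) ℚ.* sumℚ g          ≡⟨ scale (sumℚ f) (sumℚ g) ⟨
  sumℚ f ℚ.- sumℚ g                              ∎
  where
  open ≡-Reasoning
  open +-*-Solver
  scale : ∀ x y → x ℚ.- y ≡ 1ℚ ℚ.* x ℚ.+ (ℚ.- 1ℚ) ℚ.* y
  scale = solve 2 (λ x y → x :- y := con 1ℚ :* x :+ (con (ℚ.- 1ℚ)) :* y) refl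

-- The number m as a rational, kept as a sum of ones so that the lemmas on sums apply to it
-- directly.
dimension : ℕ → ℚ
dimension m = sumℚ {m} (λ _ → 1ℚ)

dimension-pos : ∀ m → ℚ.Positive (dimension (suc m))
dimension-pos m = ℚ.positive (ℚ.+-mono-<-≤ (ℚ.positive⁻¹ 1ℚ) (nonneg m))
  where
  nonneg : ∀ k → 0ℚ ℚ.≤ dimension k
  nonneg zero = ℚ.≤-refl
  nonneg (suc k) = ℚ.+-mono-≤ (ℚ.nonNegative⁻¹ 1ℚ) (nonneg k)

vertexℚ : ∀ {m} → ℚ → ℚ → Fin m → Vector ℚ m
vertexℚ s t i k = s ℚ.* kronecker i k ℚ.+ t

-- The weight `n` is arbitrary because three kinds occur: the constant 1, the difference of two
-- vertices, and the normal vector of a hyperplane.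
sum-product-vertexℚ : ∀ {m} (n : Vector ℚ m) s t i →
  sumℚ (λ k → n k ℚ.* vertexℚ s t i k) ≡ s ℚ.* n i ℚ.+ t ℚ.* sumℚ n
sum-product-vertexℚ n s t i = begin
  sumℚ (λ k → n k ℚ.* (s ℚ.* kronecker i k ℚ.+ t))
    ≡⟨ sum-cong-≗ (λ k → expand (n k) s (kronecker i k) t) ⟩
  sumℚ (λ k → s ℚ.* (kronecker i k ℚ.* n k) ℚ.+ t ℚ.* n k)
    ≡⟨ sum-linear s t (λ k → kronecker i k ℚ.* n k) n ⟩
  s ℚ.* sumℚ (λ k → kronecker i k ℚ.* n k) ℚ.+ t ℚ.* sumℚ n
    ≡⟨ cong (λ x → s ℚ.* x ℚ.+ t ℚ.* sumℚ n) (sum-kronecker n i) ⟩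
  s ℚ.* n i ℚ.+ t ℚ.* sumℚ n ∎
  where
  open ≡-Reasoning
  open +-*-Solver
  expand : ∀ n s e t → n ℚ.* (s ℚ.* e ℚ.+ t) ≡ s ℚ.* (e ℚ.* n) ℚ.+ t ℚ.* n
  expand = solve 4 (λ n s e t → n :* (s :* e :+ t) := s :* (e :* n) :+ t :* n) refl

sum-vertexℚ : ∀ {m} s t (i : Fin m) → sumℚ (vertexℚ s t i) ≡ s ℚ.+ t ℚ.* dimension m
sum-vertexℚ {m} s t i = begin
  sumℚ (vertexℚ s t i)                 ≡⟨ sum-cong-≗ (λ k → sym (ℚ.*-identityˡ (vertexℚ s t i k))) ⟩
  sumℚ (λ k → 1ℚ ℚ.* vertexℚ s t i k)  ≡⟨ sum-product-vertexℚ {m} (λ _ → 1ℚ) s t i ⟩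
  s ℚ.* 1ℚ ℚ.+ t ℚ.* dimension m       ≡⟨ cong (ℚ._+ t ℚ.* dimension m) (ℚ.*-identityʳ s) ⟩
  s ℚ.+ t ℚ.* dimension m              ∎
  where open ≡-Reasoning

-- Expanding only one factor of each square leaves two instances of
-- sum-product-vertexℚ with the difference vector as weight.
sum-square-difference : ∀ {m} s t t' (i i' : Fin m) →
  let v = λ k → vertexℚ s t i k ℚ.- vertexℚ s t' i' k
      κ = kronecker i i'
  in sumℚ (λ k → v k ℚ.* v k)
       ≡ s ℚ.* s ℚ.* (1ℚ ℚ.+ 1ℚ ℚ.- (κ ℚ.+ κ)) ℚ.+ dimension m ℚ.* ((t ℚ.- t') ℚ.* (t ℚ.- t'))
sum-square-difference {m} s t t' i i' = begin
  sumℚ (λ k → v k ℚ.* v k)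
    ≡⟨ sum-cong-≗ (λ k → expand (v k) (p k) (q k)) ⟩
  sumℚ (λ k → v k ℚ.* p k ℚ.- v k ℚ.* q k)
    ≡⟨ sum-difference (λ k → v k ℚ.* p k) (λ k → v k ℚ.* q k) ⟩
  sumℚ (λ k → v k ℚ.* p k) ℚ.- sumℚ (λ k → v k ℚ.* q k)
    ≡⟨ cong₂ ℚ._-_ (sum-product-vertexℚ v s t i) (sum-product-vertexℚ v s t' i') ⟩
  (s ℚ.* v i ℚ.+ t ℚ.* sumℚ v) ℚ.- (s ℚ.* v i' ℚ.+ t' ℚ.* sumℚ v)
    ≡⟨ cong₂ (λ x y → (s ℚ.* x ℚ.+ t ℚ.* sumℚ v) ℚ.- (s ℚ.* y ℚ.+ t' ℚ.* sumℚ v)) vᵢ vᵢ' ⟩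
  (s ℚ.* a ℚ.+ t ℚ.* sumℚ v) ℚ.- (s ℚ.* b ℚ.+ t' ℚ.* sumℚ v)
    ≡⟨ cong (λ x → (s ℚ.* a ℚ.+ t ℚ.* x) ℚ.- (s ℚ.* b ℚ.+ t' ℚ.* x)) sum-v ⟩
  (s ℚ.* a ℚ.+ t ℚ.* c) ℚ.- (s ℚ.* b ℚ.+ t' ℚ.* c)
    ≡⟨ solve 5 (λ s t t' κ M →
         (s :* ((s :* con 1ℚ :+ t) :- (s :* κ :+ t')) :+ t :* ((s :+ t :* M) :- (s :+ t' :* M)))
         :- (s :* ((s :* κ :+ t) :- (s :* con 1ℚ :+ t')) :+ t' :* ((s :+ t :* M) :- (s :+ t' :* M)))
         := s :* s :* (con 1ℚ :+ con 1ℚ :- (κ :+ κ)) :+ M :* ((t :- t') :* (t :- t')))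
         refl s t t' κ M ⟩
  s ℚ.* s ℚ.* (1ℚ ℚ.+ 1ℚ ℚ.- (κ ℚ.+ κ)) ℚ.+ M ℚ.* ((t ℚ.- t') ℚ.* (t ℚ.- t')) ∎
  where
  open ≡-Reasoning
  open +-*-Solver
  p q v : Vector ℚ m
  p = vertexℚ s t i
  q = vertexℚ s t' i'
  v k = p k ℚ.- q k
  M κ a b c : ℚ
  M = dimension m
  κ = kronecker i i'
  a = (s ℚ.* 1ℚ ℚ.+ t) ℚ.- (s ℚ.* κ ℚ.+ t')
  b = (s ℚ.* κ ℚ.+ t) ℚ.- (s ℚ.* 1ℚ ℚ.+ t')
  c = (s ℚ.+ t ℚ.* M) ℚ.- (s ℚ.+ t' ℚ.* M)
  expand : ∀ v p q → v ℚ.* (p ℚ.- q) ≡ v ℚ.* p ℚ.- v ℚ.* q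
  expand = solve 3 (λ v p q → v :* (p :- q) := v :* p :- v :* q) refl
  difference-at : ∀ k {e e'} → kronecker i k ≡ e → kronecker i' k ≡ e' →
                  v k ≡ (s ℚ.* e ℚ.+ t) ℚ.- (s ℚ.* e' ℚ.+ t')
  difference-at k = cong₂ (λ e e' → (s ℚ.* e ℚ.+ t) ℚ.- (s ℚ.* e' ℚ.+ t'))
  vᵢ : v i ≡ a
  vᵢ = difference-at i (kronecker-diagonal i) (kronecker-sym i' i)
  vᵢ' : v i' ≡ b
  vᵢ' = difference-at i' refl (kronecker-diagonal i')
  sum-v : sumℚ v ≡ c
  sum-v = trans (sum-difference p q) (cong₂ ℚ._-_ (sum-vertexℚ s t i) (sum-vertexℚ s t' i'))

-- Vertices and squared distances over the real numbers

seq-sum : ∀ {m} (f : Vector ℝ m) j → seq (sum f) j ≡ sumℚ (λ k → seq (f k) j)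
seq-sum {zero} f j = refl
seq-sum {suc m} f j = cong (seq (f zero) j ℚ.+_) (seq-sum (λ k → f (suc k)) j)

vertex : ∀ {m} → ℝ → ℝ → Fin m → Point m
vertex s t i k = s * fromℚ (kronecker i k) + t

-- Every index of the sequences gives an instance of the rational identity, so no estimate is
-- involved.
⟨-,vertex⟩ : ∀ {m} (n : Point m) s t i → ⟨ n , vertex s t i ⟩ ≈ s * n i + t * sum n
⟨-,vertex⟩ n s t i = ≈-pointwise {⟨ n , vertex s t i ⟩} {s * n i + t * sum n} λ j → begin
  seq ⟨ n , vertex s t i ⟩ j
    ≡⟨ seq-sum (zipWith _*_ n (vertex s t i)) j ⟩
  sumℚ (λ k → seq (n k) j ℚ.* vertexℚ (seq s j) (seq t j) i k)
    ≡⟨ sum-product-vertexℚ (λ k → seq (n k) j) (seq s j) (seq t j) i ⟩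
  seq s j ℚ.* seq (n i) j ℚ.+ seq t j ℚ.* sumℚ (λ k → seq (n k) j)
    ≡⟨ cong (λ x → seq s j ℚ.* seq (n i) j ℚ.+ seq t j ℚ.* x) (seq-sum n j) ⟨
  seq (s * n i + t * sum n) j ∎
  where open ≡-Reasoning

normSquare : ∀ {m} → Point m → ℝ
normSquare v = ⟨ v , v ⟩

-- The squares of `s` and `r` stay separate factors: this identity holds term by term, whereas the
-- values of the two squares will be known only up to `_≈_`.
normSquare-vertex-difference : ∀ {m} s h h' r (i i' : Fin m) →
  normSquare (zipWith _-_ (vertex s (fromℚ h * r) i) (vertex s (fromℚ h' * r) i'))
    ≈ fromℚ (1ℚ ℚ.+ 1ℚ ℚ.- (kronecker i i' ℚ.+ kronecker i i')) * (s * s)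
      + fromℚ (dimension m ℚ.* ((h ℚ.- h') ℚ.* (h ℚ.- h'))) * (r * r)
normSquare-vertex-difference {m} s h h' r i i' = ≈-pointwise
  {normSquare v}
  {fromℚ (1ℚ ℚ.+ 1ℚ ℚ.- (κ ℚ.+ κ)) * (s * s) + fromℚ (dimension m ℚ.* ((h ℚ.- h') ℚ.* (h ℚ.- h'))) * (r * r)}
  λ j → trans (seq-sum (zipWith _*_ v v) j)
    (trans (sum-square-difference (seq s j) (h ℚ.* seq r j) (h' ℚ.* seq r j) i i')
      (solve 6 (λ s r h h' κ M →
        s :* s :* (con 1ℚ :+ con 1ℚ :- (κ :+ κ)) :+ M :* ((h :* r :- h' :* r) :* (h :* r :- h' :* r))
        := (con 1ℚ :+ con 1ℚ :- (κ :+ κ)) :* (s :* s) :+ M :* ((h :- h') :* (h :- h')) :* (r :* r))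
        refl (seq s j) (seq r j) h h' κ (dimension m)))
  where
  open +-*-Solver
  v : Point m
  v = zipWith _-_ (vertex s (fromℚ h * r) i) (vertex s (fromℚ h' * r) i')
  κ : ℚ
  κ = kronecker i i'

normSquare-zero : ∀ {m} (v : Point m) → (∀ k → v k ≈ 0ℝ) → normSquare v ≈ 0ℝ
normSquare-zero {zero} v v≈0 = ≈-refl {0ℝ}
normSquare-zero {suc m} v v≈0 = ≈-trans {normSquare v} {0ℝ + 0ℝ} {0ℝ}
  (+-cong {v zero * v zero} {0ℝ} {normSquare (λ k → v (suc k))} {0ℝ}
    (x*0≈0 (v zero) {v zero} (v≈0 zero))
    (normSquare-zero (λ k → v (suc k)) (λ k → v≈0 (suc k))))
  (≈-pointwise {0ℝ + 0ℝ} {0ℝ} λ _ → refl)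

-- The hypotheses bottom and top below say that the hyperplane with normal n
-- contains all s eᵢ and all s eᵢ + τ (1, …, 1).
module _ {c ℓ : Level} (R : CommutativeRing c ℓ) where
  open CommutativeRing R using (Carrier; 0#; 1#; +-group; semiring; setoid; zeroʳ; *-identityˡ)
    renaming (_≈_ to _≈ᴿ_; *-congˡ to *ᴿ-congˡ; _+_ to _+ᴿ_; _*_ to _*ᴿ_; trans to transᴿ; sym to symᴿ)
  open SemiringSum semiring using (sum-cong-≋)
    renaming (sum to sumᴿ; *-distribˡ-sum to *ᴿ-distribˡ-sum; *-distribʳ-sum to *ᴿ-distribʳ-sum)

  -- Cancellation at zero is all that the argument asks of the coefficients, so inverses of square
  -- roots never appear.
  LeftCancellable : Carrier → Set _
  LeftCancellable a = ∀ {x} → a *ᴿ x ≈ᴿ 0# → x ≈ᴿ 0#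

  prism-normal-zero : ∀ {m} {s τ} (n : Vector Carrier (suc m)) offset →
    LeftCancellable s → LeftCancellable τ → LeftCancellable (sumᴿ {suc m} (λ _ → 1#)) →
    (∀ i → s *ᴿ n i ≈ᴿ offset) → (∀ i → s *ᴿ n i +ᴿ τ *ᴿ sumᴿ n ≈ᴿ offset) →
    ∀ i → n i ≈ᴿ 0#
  prism-normal-zero {m} {s} {τ} n offset s-cancel τ-cancel M-cancel bottom top i =
    s-cancel (transᴿ (bottom i) (M-cancel M*offset≈0))
    where
    open SetoidReasoning setoid
    -- The equations `top` and `bottom` for the same `i` differ by `τ` times the sum of `n`, which
    -- is therefore zero.
    sum-n≈0 : sumᴿ n ≈ᴿ 0#
    sum-n≈0 = τ-cancel (GroupProperties.identityʳ-unique +-group (s *ᴿ n i) (τ *ᴿ sumᴿ n)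
      (transᴿ (top i) (symᴿ (bottom i))))
    -- Adding `bottom` over all `i` evaluates this product as `s` times the sum of `n`. Hence the
    -- offset vanishes, and by `bottom` so does each `s *ᴿ n i`.
    M*offset≈0 : sumᴿ {suc m} (λ _ → 1#) *ᴿ offset ≈ᴿ 0#
    M*offset≈0 = begin
      sumᴿ {suc m} (λ _ → 1#) *ᴿ offset ≈⟨ *ᴿ-distribʳ-sum {suc m} offset (λ _ → 1#) ⟩
      sumᴿ {suc m} (λ _ → 1# *ᴿ offset) ≈⟨ sum-cong-≋ {suc m} (λ k → transᴿ (*-identityˡ offset) (symᴿ (bottom k))) ⟩
      sumᴿ (λ k → s *ᴿ n k)     ≈⟨ *ᴿ-distribˡ-sum s n ⟨
      s *ᴿ sumᴿ n               ≈⟨ *ᴿ-congˡ sum-n≈0 ⟩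
      s *ᴿ 0#                   ≈⟨ zeroʳ s ⟩
      0#                        ∎

-- The prism

height : Fin 4 → ℕ
height = Vec.lookup (0 ∷ 182 ∷ 209 ∷ 391 ∷ [])

-- The values √(120² + Δ²) for the differences Δ of two heights; the diagonal, where Δ = 0, holds
-- the edge length of the simplex.
hypotenuse : Fin 4 → Fin 4 → ℕ
hypotenuse j j' = Vec.lookup (Vec.lookup rows j) j'
  where
  rows = (120 ∷ 218 ∷ 241 ∷ 409 ∷ [])
       ∷ (218 ∷ 120 ∷ 123 ∷ 241 ∷ [])
       ∷ (241 ∷ 123 ∷ 120 ∷ 218 ∷ [])
       ∷ (409 ∷ 241 ∷ 218 ∷ 120 ∷ []) ∷ []

-- The argument b tells whether the two vertices lie on the same vertical line.
prismDist : Bool → Fin 4 → Fin 4 → ℕ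
prismDist b j j' = if b then ℕ.∣ height j - height j' ∣ else hypotenuse j j'

fromℕ : ℕ → ℚ
fromℕ k = + k ℚ./ 1

-- The coefficient of 7200 = s² is 0 on a common vertical line and 2 otherwise, so the horizontal
-- part is 0 or 14400 = 120².
prismDist² : Bool → Fin 4 → Fin 4 → ℚ
prismDist² b j j' = (1ℚ ℚ.+ 1ℚ ℚ.- (indicator b ℚ.+ indicator b)) ℚ.* fromℕ 7200 ℚ.+ d ℚ.* d
  where
  d : ℚ
  d = fromℕ (height j) ℚ.- fromℕ (height j')

-- The Pythagorean triples enter here: all 32 cases are decided by evaluation.
prismDist-square : ∀ b j j' → prismDist² b j j' ≡ fromℕ (prismDist b j j') ℚ.* fromℕ (prismDist b j j')
prismDist-square = λ where
    false → from-yes (all? λ j → all? λ j' → square? false j j')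
    true  → from-yes (all? λ j → all? λ j' → square? true j j')
  where
  square? = λ b j j' → prismDist² b j j' ℚ.≟ fromℕ (prismDist b j j') ℚ.* fromℕ (prismDist b j j')

prismDist≤409 : ∀ b j j' → prismDist b j j' ℕ.≤ 409
prismDist≤409 false = from-yes (all? λ j → all? λ j' → prismDist false j j' ℕ.≤? 409)
prismDist≤409 true = from-yes (all? λ j → all? λ j' → prismDist true j j' ℕ.≤? 409)

prismDist≡0 : ∀ b j j' → prismDist b j j' ≡ 0 → b ≡ true × j ≡ j'
prismDist≡0 false j j' eq = contradiction eq (nonzero j j')
  where
  nonzero : ∀ j j' → prismDist false j j' ≢ 0
  nonzero = from-yes (all? λ j → all? λ j' → ¬? (prismDist false j j' ℕ.≟ 0))
prismDist≡0 true j j' eq = refl , same-height j j' eq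
  where
  same-height : ∀ j j' → prismDist true j j' ≡ 0 → j ≡ j'
  same-height = from-yes (all? λ j → all? λ j' → (prismDist true j j' ℕ.≟ 0) →-dec (j ≟ j'))

-- The points of the prism and their distances

module Prism (m : ℕ) where

  M : ℚ
  M = dimension (suc (suc m))

  instance
    M>0 : ℚ.Positive M
    M>0 = dimension-pos (suc m)

    M≢0 : ℚ.NonZero M
    M≢0 = ℚ.pos⇒nonZero M

    1/M>0 : ℚ.Positive (ℚ.1/ M)
    1/M>0 = ℚ.1/pos⇒pos M

  s r : ℝ
  s = √ fromℚ (fromℕ 7200)
  r = √ fromℚ (ℚ.1/ M)

  Index : Set
  Index = Fin 4 × Fin (suc (suc m))

  prismVertex : Index → Point (suc (suc m))
  prismVertex (j , i) = vertex s (fromℚ (fromℕ (height j)) * r) i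

  indexDist : Index → Index → ℕ
  indexDist (j , i) (j' , i') = prismDist (does (i ≟ i')) j j'

  normSquare-difference : ∀ a b → let z = fromℤ (+ indexDist a b) in
    normSquare (zipWith _-_ (prismVertex a) (prismVertex b)) ≈ z * z
  normSquare-difference (j , i) (j' , i') = ≈-trans {D} {A * (s * s) + B * (r * r)} {z * z}
    (normSquare-vertex-difference s (fromℕ (height j)) (fromℕ (height j')) r i i')
    (≈-trans {A * (s * s) + B * (r * r)} {A * fromℚ (fromℕ 7200) + B * fromℚ (ℚ.1/ M)} {z * z}
      (+-cong {A * (s * s)} {A * fromℚ (fromℕ 7200)} {B * (r * r)} {B * fromℚ (ℚ.1/ M)}
        (*-congˡ A {s * s} {fromℚ (fromℕ 7200)} s²≈7200)
        (*-congˡ B {r * r} {fromℚ (ℚ.1/ M)} r²≈1/M))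
      -- Both sides are now constant sequences. What remains is the cancellation of `M` against
      -- `ℚ.1/ M` and the finite check.
      (≈-pointwise {A * fromℚ (fromℕ 7200) + B * fromℚ (ℚ.1/ M)} {z * z} λ _ →
        trans (cong (κ' ℚ.* fromℕ 7200 ℚ.+_) cancel) (prismDist-square b j j')))
    where
    b : Bool
    b = does (i ≟ i')
    κ' d : ℚ
    κ' = 1ℚ ℚ.+ 1ℚ ℚ.- (indicator b ℚ.+ indicator b)
    d = fromℕ (height j) ℚ.- fromℕ (height j')
    A B D z : ℝ
    A = fromℚ κ'
    B = fromℚ (M ℚ.* (d ℚ.* d))
    D = normSquare (zipWith _-_ (prismVertex (j , i)) (prismVertex (j' , i')))
    z = fromℤ (+ prismDist b j j')
    s²≈7200 : s * s ≈ fromℚ (fromℕ 7200)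
    s²≈7200 = √-square (fromℚ (fromℕ 7200)) (fromℚ-mono-≤ (ℚ.nonNegative⁻¹ (fromℕ 7200)))
    r²≈1/M : r * r ≈ fromℚ (ℚ.1/ M)
    r²≈1/M = √-square (fromℚ (ℚ.1/ M)) (fromℚ-mono-≤ (ℚ.<⇒≤ (ℚ.positive⁻¹ (ℚ.1/ M))))
    cancel : M ℚ.* (d ℚ.* d) ℚ.* (ℚ.1/ M) ≡ d ℚ.* d
    cancel = trans (solve 3 (λ M e w → M :* e :* w := (M :* w) :* e) refl M (d ℚ.* d) (ℚ.1/ M))
      (trans (cong (ℚ._* (d ℚ.* d)) (ℚ.*-inverseʳ M)) (ℚ.*-identityˡ (d ℚ.* d)))
      where open +-*-Solver

  dist-prismVertex : ∀ a b → dist (prismVertex a) (prismVertex b) ≈ fromℤ (+ indexDist a b)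
  dist-prismVertex a b = √-unique {D} {z} 0≤D (fromℤ-mono-≤ {+ 0} {+ indexDist a b} (ℤ.+≤+ ℕ.z≤n)) (normSquare-difference a b)
    where
    D z : ℝ
    D = normSquare (zipWith _-_ (prismVertex a) (prismVertex b))
    z = fromℤ (+ indexDist a b)
    0≤z² : 0ℝ ≤ z * z
    0≤z² = fromℚ-mono-≤ {0ℚ} {q ℚ.* q} (ℚ.nonNegative⁻¹ (q ℚ.* q) {{ℚ.nonNeg*nonNeg⇒nonNeg q q}})
      where
      q : ℚ
      q = fromℕ (indexDist a b)
      instance
        q≥0 : ℚ.NonNegative q
        q≥0 = ℚ.nonNegative (fromℚ-cancel-≤ {0ℚ} {q} (fromℤ-mono-≤ {+ 0} {+ indexDist a b} (ℤ.+≤+ ℕ.z≤n)))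

    -- The sign of this sum of squares is read off from its known value `z * z`.
    0≤D : 0ℝ ≤ D
    0≤D = ≤-trans {0ℝ} {z * z} {D} 0≤z² (proj₂ (normSquare-difference a b))

  indexDist-injective : ∀ a b → indexDist a b ≡ 0 → a ≡ b
  indexDist-injective (j , i) (j' , i') eq
    with same-line , same-layer ← prismDist≡0 (does (i ≟ i')) j j' eq =
    cong₂ _,_ same-layer (does-true i i' same-line)
    where
    does-true : ∀ {n} (i i' : Fin n) → does (i ≟ i') ≡ true → i ≡ i'
    -- This single pattern is exhaustive: in the `no` case `same` would prove `false ≡ true`.
    does-true i i' same with yes i≡i' ← i ≟ i' = i≡i'

  -- Coinciding points have squared distance 0, which is also the square of the natural number
  -- `indexDist a b`. That number is then 0, and no coordinates with square roots are compared.
  prismVertex-distinct : ∀ a b → (∀ k → prismVertex a k ≈ prismVertex b k) → a ≡ b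
  prismVertex-distinct a b a≈b = indexDist-injective a b (zero-square (indexDist a b) z²≈0)
    where
    v : Point (suc (suc m))
    v = zipWith _-_ (prismVertex a) (prismVertex b)
    z : ℝ
    z = fromℤ (+ indexDist a b)
    v≈0 : ∀ k → v k ≈ 0ℝ
    v≈0 k = ≈-trans {v k} {prismVertex b k - prismVertex b k} {0ℝ}
      (+-cong {prismVertex a k} {prismVertex b k} { - prismVertex b k} { - prismVertex b k}
        (a≈b k) (≈-refl { - prismVertex b k}))
      (≈-pointwise {prismVertex b k - prismVertex b k} {0ℝ} λ i → ℚ.+-inverseʳ (seq (prismVertex b k) i))
    z²≈0 : z * z ≈ 0ℝ
    z²≈0 = ≈-trans {z * z} {normSquare v} {0ℝ}
      (≈-sym {normSquare v} {z * z} (normSquare-difference a b)) (normSquare-zero v v≈0)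
    zero-square : ∀ k → fromℤ (+ k) * fromℤ (+ k) ≈ 0ℝ → k ≡ 0
    zero-square zero _ = refl
    zero-square (suc k) k²≈0 = contradiction (fromℤ-cancel-≤ {+ suc k} {+ 0} (proj₁ k≈0)) λ { (ℤ.+≤+ ()) }
      where
      k≈0 : fromℤ (+ suc k) ≈ 0ℝ
      k≈0 = fromℚ-cancel-* {fromℕ (suc k)} {{ℚ.pos⇒nonZero (fromℕ (suc k)) {{ℚ.normalize-pos (suc k) 1}}}} {fromℤ (+ suc k)} k²≈0

  -- The layers at the heights 0 and 182 form a prism of full dimension; they supply `bottom` and
  -- `top`, with `τ` equal to 182 `r`.
  not-in-hyperplane : ∀ (H : Hyperplane (suc (suc m))) → ¬ (∀ a → prismVertex a ∈ H)
  not-in-hyperplane H on-H = normal≉0 (prism-normal-zero ℝ-commutativeRing {s = s} {τ = τ} normal offset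
    (λ {x} → √-cancel-* {fromℕ 7200} {x})
    (λ {x} τx≈0 → √-cancel-* {ℚ.1/ M} {x} (fromℚ-cancel-* {fromℕ 182} {r * x}
      (≈-trans {fromℚ (fromℕ 182) * (r * x)} {τ * x} {0ℝ}
        (≈-pointwise {fromℚ (fromℕ 182) * (r * x)} {τ * x} λ i → sym (ℚ.*-assoc (fromℕ 182) (seq r i) (seq x i)))
        τx≈0)))
    (λ {x} Mx≈0 → fromℚ-cancel-* {M} {x} (≈-trans {fromℚ M * x} {Σ1 * x} {0ℝ}
      (≈-pointwise {fromℚ M * x} {Σ1 * x} λ i →
        cong (ℚ._* seq x i) (sym (seq-sum {suc (suc m)} (λ _ → fromℚ 1ℚ) i)))
      Mx≈0))
    -- The lowest layer has height 0, so its equation loses the term with the sum of the normal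
    -- vector.
    (λ i → ≈-trans {s * normal i} {s * normal i + fromℚ 0ℚ * r * sum normal} {offset}
      (≈-pointwise {s * normal i} {s * normal i + fromℚ 0ℚ * r * sum normal} λ k →
        solve 3 (λ a r b → a := a :+ con 0ℚ :* r :* b) refl (seq (s * normal i) k) (seq r k) (seq (sum normal) k))
      (equation zero i))
    (equation (suc zero)))
    where
    open Hyperplane H
    open +-*-Solver
    τ Σ1 : ℝ
    τ = fromℚ (fromℕ 182) * r
    Σ1 = sum {suc (suc m)} (λ _ → fromℚ 1ℚ)
    equation : ∀ j i → s * normal i + fromℚ (fromℕ (height j)) * r * sum normal ≈ offset
    equation j i = ≈-trans {s * normal i + t * sum normal} {⟨ normal , prismVertex (j , i) ⟩} {offset}
      (≈-sym {⟨ normal , prismVertex (j , i) ⟩} {s * normal i + t * sum normal} (⟨-,vertex⟩ normal s t i))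
      (on-H (j , i))
      where
      t : ℝ
      t = fromℚ (fromℕ (height j)) * r

  -- Numbering of the points and the diameter

  index : Fin (4 ℕ.* suc (suc m)) → Index
  index = remQuot {4} (suc (suc m))

  position : Index → Fin (4 ℕ.* suc (suc m))
  position = uncurry combine

  index-position : ∀ a → index (position a) ≡ a
  index-position (j , i) = remQuot-combine {4} j i

  index-injective : ∀ x y → index x ≡ index y → x ≡ y
  index-injective x y eq = trans (sym (combine-remQuot {4} (suc (suc m)) x))
    (trans (cong position eq) (combine-remQuot {4} (suc (suc m)) y))

  prism : IntegralPointSet (suc (suc m)) (4 ℕ.* suc (suc m))
  prism = record
    { point = λ x → prismVertex (index x)
    ; distinct = λ x y x≢y x≈y → x≢y (index-injective x y (prismVertex-distinct (index x) (index y) x≈y))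
    ; integral = λ x y → + indexDist (index x) (index y) , dist-prismVertex (index x) (index y)
    ; full = λ H on-H → not-in-hyperplane H λ a →
        subst (λ b → prismVertex b ∈ H) (index-position a) (on-H (position a))
    }

  prism-diameter : IsDiameter prism (fromℤ (+ 409))
  prism-diameter = bound , position lowest , position highest ,
    subst₂ (λ a b → dist (prismVertex a) (prismVertex b) ≈ fromℤ (+ 409))
      (sym (index-position lowest)) (sym (index-position highest))
      (dist-prismVertex lowest highest)
    where
    lowest highest : Index
    lowest = zero , zero
    -- A second vertical line exists because the dimension is at least 2; on a single line the
    -- extreme layers are only 391 apart.
    highest = suc (suc (suc zero)) , suc zero
    bound : ∀ x y → dist (point prism x) (point prism y) ≤ fromℤ (+ 409)
    bound x y = ≤-trans {dist (point prism x) (point prism y)} {fromℤ (+ indexDist a b)} {fromℤ (+ 409)}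
      (proj₁ (dist-prismVertex a b))
      (fromℤ-mono-≤ {+ indexDist a b} {+ 409}
        (ℤ.+≤+ (prismDist≤409 (does (proj₂ a ≟ proj₂ b)) (proj₁ a) (proj₁ b))))
      where
      a b : Index
      a = index x
      b = index y

-- Existence of the minimal diameter

-- If there were no least element, strong induction would refute `Q` everywhere: a `k` that
-- satisfies `Q` while all smaller numbers fail would be least.
¬¬-least : (Q : ℕ → Set) → ∀ n → Q n → ¬ ¬ (∃[ k ] (Q k × (∀ j → Q j → k ℕ.≤ j)))
¬¬-least Q n Qn ¬least = <-rec (λ k → ¬ Q k)
  (λ k ¬Q<k Qk → ¬least (k , Qk , λ j Qj → ℕ.≮⇒≥ λ j<k → ¬Q<k j<k Qj)) n Qn

IsDiameter-resp-≈ : ∀ {m n} (P : IntegralPointSet m n) {x y} → x ≈ y → IsDiameter P x → IsDiameter P y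
IsDiameter-resp-≈ P {x} {y} x≈y (bound , i , j , attained) =
  (λ i j → ≤-trans {dist (point P i) (point P j)} {x} {y} (bound i j) (proj₁ x≈y)) ,
  i , j , ≈-trans {dist (point P i) (point P j)} {x} {y} attained x≈y

-- A diameter is attained, hence equal to an integral distance, and square roots are nonnegative.
-- This reduces the minimum over real diameters to a least natural number.
IsDiameter⇒natural : ∀ {m n} (P : IntegralPointSet m n) {diam} → IsDiameter P diam →
                     ∃[ k ] diam ≈ fromℤ (+ k)
IsDiameter⇒natural {m} P {diam} (_ , i , j , attained) with integral P i j
... | + k , eq = k , ≈-trans {diam} {D} {fromℤ (+ k)} (≈-sym {D} {diam} attained) eq
  where
  D : ℝ
  D = dist (point P i) (point P j)
... | -[1+ k ] , eq = contradiction (fromℤ-cancel-≤ {+ 0} { -[1+ k ]}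
    (≤-trans {0ℝ} {dist (point P i) (point P j)} {fromℤ -[1+ k ]}
      (√-nonneg (normSquare (zipWith _-_ (point P i) (point P j)))) (proj₁ eq)))
    λ ()

-- The minimal diameter is the least natural number realised as a diameter. It exists up to double
-- negation because `k` is realised, and for the same reason it is at most `k`.
d≤-fromℕ : ∀ {m n} k (P : IntegralPointSet m n) → IsDiameter P (fromℤ (+ k)) → d⟨ m , n ⟩≤ fromℤ (+ k)
d≤-fromℕ {m} {n} k P k-diam = record
  { witness = P , fromℤ (+ k) , k-diam , ≤-refl {fromℤ (+ k)}
  ; minimum = λ ¬min → ¬¬-least Realised k (P , k-diam) λ { (l , realised , least) →
      ¬min (fromℤ (+ l)
        , (realised , λ P' diam is-diam →
            let l' , diam≈l' = IsDiameter⇒natural P' {diam} is-diam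
            in ≤-trans {fromℤ (+ l)} {fromℤ (+ l')} {diam}
                 (fromℤ-mono-≤ {+ l} {+ l'}
                   (ℤ.+≤+ (least l' (P' , IsDiameter-resp-≈ P' {diam} {fromℤ (+ l')} diam≈l' is-diam))))
                 (proj₂ diam≈l'))
        , fromℤ-mono-≤ {+ l} {+ k} (ℤ.+≤+ (least k (P , k-diam)))) }
  }
  where
  Realised : ℕ → Set
  Realised l = ∃[ P ] IsDiameter {m} {n} P (fromℤ (+ l))

mainTheorem4 : ∀ (m : ℕ) → 2 ℕ.≤ m → d⟨ m , 4 ℕ.* m ⟩≤ (fromℤ (+ 409))
mainTheorem4 (suc (suc m)) _ = d≤-fromℕ 409 prism prism-diameter
  where open Prism m
mainTheorem4 (suc zero) (ℕ.s≤s ())
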